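{- Let $N$ be a positive integer and define polynomials $P_n(x),Q_n(x)$ ($n\ge0$) by $P_0=1$, $P_1=(N+1)-x$, $Q_0=1$, $Q_1=N+1$, and for $n\ge2$ $$P_n=a_nP_{n-1}+b_nP_{n-2},\qquad Q_n=a_nQ_{n-1}+b_nQ_{n-2},$$ where $a_n=N+n$, $b_{2m}=mx$ and $b_{2m+1}=-(N+m)x$ for $m\ge1$. Then for every $n\ge1$: $$P_{2n-1}(x)=\sum_{j=0}^{n}(-1)^j\binom{n}{j}\prod_{l=1}^{2n-j-1}(N+l)\cdot x^j,\qquad P_{2n}(x)=\sum_{j=0}^{n}(-1)^j\binom{n}{j}\prod_{l=1}^{2n-j}(N+l)\cdot x^j,$$ $$Q_{2n-1}(x)=\sum_{j=0}^{n-1}\sum_{k=0}^{j}(-1)^{j-k}(2n-j-1)_k\binom{n-k-1}{j-k}\prod_{l=k+1}^{2n-j-1}(N+l)\cdot x^j,$$ $$Q_{2n}(x)=\sum_{j=0}^{n}\sum_{k=0}^{j}(-1)^{j-k}(2n-j)_k\binom{n-k-1}{j-k}\prod_{l=k+1}^{2n-j}(N+l)\cdot x^j.$$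
   Context: $(y)_k=y(y-1)\cdots(y-k+1)$ denotes the falling factorial, $(y)_0=1$. Conventions: $\binom{a}{k}=0$ for integers $0\le a<k$, $\binom{ -1}{0}=1$, and an empty product equals $1$. The quotients $P_n(x)/Q_n(x)$ are the convergents of the continued fraction expansion $\frac{x^N/N!}{e^x-\sum_{i=0}^{N-1}x^i/i!}=1-\cfrac{x}{N+1+\cfrac{x}{N+2-\cfrac{(N+1)x}{N+3+\cfrac{2x}{N+4-\cdots}}}}$. -}

module Defs where

open import Data.Bool.Base using (if_then_else_)
open import Data.Integer.Base as ℤ using (ℤ; +_; -[1+_]; 0ℤ; 1ℤ; -1ℤ)
open import Data.List.Base using (List; []; _∷_; map; foldr; applyUpTo)
open import Data.Nat.Base as ℕ using (ℕ; zero; suc; _≡ᵇ_)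
open import Data.Nat.Combinatorics using (_C_)
open import Data.Nat.DivMod using (_/_; _%_)
open import Data.Nat.ListAction using (product)
open import Relation.Binary.PropositionalEquality using (_≡_)

infix  4 _≈_
infixr 5 ∑ ∏
infixl 6 _⊕_ _⊖_
infixl 7 _⊗_ _·_
infixr 8 _^ₚ_

-- ℤ[x], constant coefficient first.  Trailing zeros are allowed, so the
-- equality of polynomials is _≈_, not _≡_.
Poly : Set
Poly = List ℤ

coeff : Poly → ℕ → ℤ
coeff []      _       = 0ℤ
coeff (a ∷ _) zero    = a
coeff (_ ∷ p) (suc i) = coeff p i

_≈_ : Poly → Poly → Set
p ≈ q = ∀ i → coeff p i ≡ coeff q i

0ₚ : Poly
0ₚ = []

const : ℤ → Poly
const a = a ∷ []

X : Poly
X = 0ℤ ∷ 1ℤ ∷ []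

_·_ : ℤ → Poly → Poly
a · p = map (a ℤ.*_) p

_⊕_ : Poly → Poly → Poly
[]      ⊕ q       = q
(a ∷ p) ⊕ []      = a ∷ p
(a ∷ p) ⊕ (b ∷ q) = (a ℤ.+ b) ∷ (p ⊕ q)

_⊖_ : Poly → Poly → Poly
p ⊖ q = p ⊕ (-1ℤ · q)

_⊗_ : Poly → Poly → Poly
[]      ⊗ q = []
(a ∷ p) ⊗ q = (a · q) ⊕ (0ℤ ∷ (p ⊗ q))

_^ₚ_ : Poly → ℕ → Poly
p ^ₚ zero  = const 1ℤ
p ^ₚ suc n = p ⊗ (p ^ₚ n)

-- The integers a, a+1, …, b; empty when b < a.
range : ℕ → ℕ → List ℕ
range a b = applyUpTo (a ℕ.+_) (suc b ℕ.∸ a)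

∑ : ℕ → ℕ → (ℕ → Poly) → Poly
∑ a b f = foldr _⊕_ 0ₚ (map f (range a b))

∏ : ℕ → ℕ → (ℕ → ℕ) → ℕ
∏ a b f = product (map f (range a b))

syntax ∑ a b (λ j → e) = ∑[ j from a to b ] e
syntax ∏ a b (λ l → e) = ∏[ l from a to b ] e

-- y(y-1)⋯(y-k+1)/k!.  For negative y this is the usual reflection
-- binom (-1-a) k = (-1)^k binom (a+k) k, so that binom (-1) 0 = 1.
binom : ℤ → ℕ → ℤ
binom (+ a)    k = + (a C k)
binom -[1+ a ] k = (-1ℤ ℤ.^ k) ℤ.* + ((a ℕ.+ k) C k)

a : ℕ → ℕ → Poly
a N n = const (+ (N ℕ.+ n))

-- With m = n / 2, so that n = 2m or n = 2m+1.
b : ℕ → ℕ → Poly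
b N n = if (n % 2) ≡ᵇ 0
        then (+ (n / 2)) · X
        else (ℤ.- + (N ℕ.+ n / 2)) · X

P : ℕ → ℕ → Poly
P N 0             = const 1ℤ
P N 1             = const (+ (N ℕ.+ 1)) ⊖ X
P N (suc (suc n)) = a N (suc (suc n)) ⊗ P N (suc n) ⊕ b N (suc (suc n)) ⊗ P N n

Q : ℕ → ℕ → Poly
Q N 0             = const 1ℤ
Q N 1             = const (+ (N ℕ.+ 1))
Q N (suc (suc n)) = a N (suc (suc n)) ⊗ Q N (suc n) ⊕ b N (suc (suc n)) ⊗ Q N n

{-# OPTIONS --safe #-}
module Submission where

-- Write W(m,k) = (m)_k ∏_{k<l≤m} (N+l).  With m = n - j, the claimed coefficient of x^j in
-- P_n and Q_n has the form S ⌈n/2⌉ m j, where S c m j is (-1)^j binom(c,j) W(m,0) for P and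
-- ∑_k (-1)^(j-k) binom(c-1-k, j-k) W(m,k) for Q.  In both cases
--   S (c+1) (m+1) (j+1) = (N+m+j+2) S (c+1) m (j+1) + (c+1) S c m j,
-- which is the recurrence at even index, and Pascal's rule
--   S (c+1) m (j+1) = S c m (j+1) - S c m j
-- turns it into the recurrence at odd index.  For Q the first identity holds because
-- W(m+1,k) = (N+m+1+k) W(m,k) + k W(m,k-1) makes the difference of the two sides telescope in k.

open import Defs
open import Data.Bool.Base using (true; false; T; if_then_else_)
open import Data.Integer.Base using (ℤ; +_; -[1+_]; 0ℤ; 1ℤ; -1ℤ; _-_; _^_; -_)
  renaming (_+_ to _+ℤ_; _*_ to _*ℤ_)
open import Data.Integer.Properties as ℤₚ using (pos-+; pos-*)
open import Data.Integer.Tactic.RingSolver using (solve-∀)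
open import Data.List.Base using ([]; _∷_; foldr; map; applyUpTo; [_]; _∷ʳ_)
open import Data.List.Properties using (applyUpTo-∷ʳ; map-++)
open import Data.Nat.Base
  using (ℕ; zero; suc; _+_; _*_; _∸_; _≤_; _<_; z≤n; s≤s; s≤s⁻¹; _≤ᵇ_; _≡ᵇ_)
open import Data.Nat.Combinatorics
  using (_C_; nCk+nC[k+1]≡[n+1]C[k+1]; nCn≡1; k>n⇒nCk≡0; nP1≡n; k>n⇒nPk≡0)
  renaming (_P_ to _↓_)
open import Data.Nat.Combinatorics.Base using (_P′_)
open import Data.Nat.Divisibility using (n∣m*n)
open import Data.Nat.DivMod using (m*n/n≡m; m*n%n≡0; [m+kn]%n≡m%n; +-distrib-/-∣ʳ)
open import Data.Nat.ListAction using (product)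
open import Data.Nat.ListAction.Properties using (product-++)
import Data.Nat.Properties as ℕₚ
import Data.Nat.Tactic.RingSolver as ℕ-Ring
open import Data.Product.Base using (_×_; _,_; proj₁; proj₂)
open import Data.Sum.Base using (inj₁; inj₂)
open import Function.Base using (_∘_)
open import Relation.Binary.Definitions using (tri<; tri≈; tri>)
open import Relation.Binary.PropositionalEquality
  using (_≡_; _≢_; refl; sym; trans; cong; cong₂; subst; module ≡-Reasoning)
open import Relation.Nullary using (yes; no; contradiction)
open ≡-Reasoning

-- Generalized binomial coefficients

-- Indexing by m = n - j fits the recurrence: the coefficient of x^(j+1) at index n involves that of
-- x^(j+1) at index n - 1 and that of x^j at index n - 2, and both of these belong to one and the
-- same m, one less than on the left. So W(m+1,k) is the only weight to expand. As P and Q obey the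
-- same recurrence, the passage from polynomials to coefficients is made once, for any S with the
-- properties in `IsClosedForm`. The identities are proved for all c, m and j, so c - 1 - k becomes
-- negative as soon as k ≥ c, and the theorem itself contains binom(-1,0), at j = k = n in Q_{2n}.
-- Hence Pascal's rule and absorption are established for every integer upper argument.

binom-zeroʳ : ∀ z → binom z 0 ≡ 1ℤ
binom-zeroʳ (+ a)    = refl
binom-zeroʳ -[1+ a ] = refl

-- For z ≥ 0 this is the ordinary rule. At z = -1 the two terms on the right are opposite signs and
-- cancel. For z < -1 reflection turns it into the ordinary rule with one term moved to the other
-- side.
binom-pascal : ∀ z k → binom (1ℤ +ℤ z) (suc k) ≡ binom z (suc k) +ℤ binom z k
binom-pascal (+ n) k = begin
  + (suc n C suc k)             ≡⟨ cong +_ (nCk+nC[k+1]≡[n+1]C[k+1] n k) ⟨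
  + (n C k + n C suc k)         ≡⟨ pos-+ (n C k) (n C suc k) ⟩
  + (n C k) +ℤ + (n C suc k)    ≡⟨ ℤₚ.+-comm (+ (n C k)) (+ (n C suc k)) ⟩
  + (n C suc k) +ℤ + (n C k)    ∎
binom-pascal -[1+ zero ] k = begin
  0ℤ                                                ≡⟨ cancel (-1ℤ ^ k) ⟩
  (-1ℤ ^ suc k) *ℤ 1ℤ +ℤ (-1ℤ ^ k) *ℤ 1ℤ
    ≡⟨ cong₂ (λ x y → (-1ℤ ^ suc k) *ℤ + x +ℤ (-1ℤ ^ k) *ℤ + y) (nCn≡1 (suc k)) (nCn≡1 k) ⟨
  (-1ℤ ^ suc k) *ℤ + (suc k C suc k) +ℤ (-1ℤ ^ k) *ℤ + (k C k) ∎
  where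
  cancel : ∀ s → 0ℤ ≡ -1ℤ *ℤ s *ℤ 1ℤ +ℤ s *ℤ 1ℤ
  cancel = solve-∀
binom-pascal -[1+ suc n ] k = begin
  (-1ℤ *ℤ s) *ℤ + ((n + suc k) C suc k)
    ≡⟨ regroup s (+ ((n + suc k) C suc k)) (+ ((suc n + k) C k)) ⟩
  (-1ℤ *ℤ s) *ℤ (+ ((suc n + k) C k) +ℤ + ((n + suc k) C suc k)) +ℤ s *ℤ + ((suc n + k) C k)
    ≡⟨ cong (λ m → (-1ℤ *ℤ s) *ℤ (+ ((suc n + k) C k) +ℤ + (m C suc k)) +ℤ s *ℤ + ((suc n + k) C k)) (ℕₚ.+-suc n k) ⟩
  (-1ℤ *ℤ s) *ℤ (+ ((suc n + k) C k) +ℤ + ((suc n + k) C suc k)) +ℤ s *ℤ + ((suc n + k) C k)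
    ≡⟨ cong (λ x → (-1ℤ *ℤ s) *ℤ x +ℤ s *ℤ + ((suc n + k) C k)) (pos-+ ((suc n + k) C k) _) ⟨
  (-1ℤ *ℤ s) *ℤ + ((suc n + k) C k + ((suc n + k) C suc k)) +ℤ s *ℤ + ((suc n + k) C k)
    ≡⟨ cong (λ x → (-1ℤ *ℤ s) *ℤ + x +ℤ s *ℤ + ((suc n + k) C k)) (nCk+nC[k+1]≡[n+1]C[k+1] (suc n + k) k) ⟩
  (-1ℤ *ℤ s) *ℤ + (suc (suc n + k) C suc k) +ℤ s *ℤ + ((suc n + k) C k)
    ≡⟨ cong (λ m → (-1ℤ *ℤ s) *ℤ + (suc m C suc k) +ℤ s *ℤ + ((suc n + k) C k)) (ℕₚ.+-suc n k) ⟨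
  (-1ℤ *ℤ s) *ℤ + ((suc n + suc k) C suc k) +ℤ s *ℤ + ((suc n + k) C k) ∎
  where
  s = -1ℤ ^ k
  regroup : ∀ s x y → -1ℤ *ℤ s *ℤ x ≡ -1ℤ *ℤ s *ℤ (y +ℤ x) +ℤ s *ℤ y
  regroup = solve-∀

-- Pascal's rule at 1 + z turns absorption at (z , k) and (z , k - 1) into
-- absorption at (1 + z , k), and conversely; it is trivial at z = -1.
binom-absorb : ∀ k z → + suc k *ℤ binom (1ℤ +ℤ z) (suc k) ≡ (1ℤ +ℤ z) *ℤ binom z k
binom-absorb-suc : ∀ k z →
  + suc k *ℤ binom (1ℤ +ℤ (1ℤ +ℤ z)) (suc k) - (1ℤ +ℤ (1ℤ +ℤ z)) *ℤ binom (1ℤ +ℤ z) k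
    ≡ + suc k *ℤ binom (1ℤ +ℤ z) (suc k) - (1ℤ +ℤ z) *ℤ binom z k

binom-absorb k (+ zero) = ℤₚ.i-j≡0⇒i≡j _ _ (begin
  _ ≡⟨ binom-absorb-suc k -1ℤ ⟩
  _ ≡⟨ ℤₚ.i≡j⇒i-j≡0 (binom-absorb k -1ℤ) ⟩
  0ℤ ∎)
binom-absorb k (+ suc n) = ℤₚ.i-j≡0⇒i≡j _ _ (begin
  _ ≡⟨ binom-absorb-suc k (+ n) ⟩
  _ ≡⟨ ℤₚ.i≡j⇒i-j≡0 (binom-absorb k (+ n)) ⟩
  0ℤ ∎)
binom-absorb k -[1+ zero ] = ℤₚ.*-zeroʳ (+ suc k)
binom-absorb k -[1+ suc n ] = ℤₚ.i-j≡0⇒i≡j _ _ (begin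
  _ ≡⟨ binom-absorb-suc k -[1+ suc n ] ⟨
  _ ≡⟨ ℤₚ.i≡j⇒i-j≡0 (binom-absorb k -[1+ n ]) ⟩
  0ℤ ∎)

binom-absorb-suc zero z = begin
  1ℤ *ℤ binom (1ℤ +ℤ (1ℤ +ℤ z)) 1 - (1ℤ +ℤ (1ℤ +ℤ z)) *ℤ binom (1ℤ +ℤ z) 0
    ≡⟨ cong₂ (λ x y → 1ℤ *ℤ x - (1ℤ +ℤ (1ℤ +ℤ z)) *ℤ y) (binom-pascal (1ℤ +ℤ z) 0) (binom-zeroʳ (1ℤ +ℤ z)) ⟩
  1ℤ *ℤ (binom (1ℤ +ℤ z) 1 +ℤ binom (1ℤ +ℤ z) 0) - (1ℤ +ℤ (1ℤ +ℤ z)) *ℤ 1ℤ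
    ≡⟨ cong (λ x → 1ℤ *ℤ (binom (1ℤ +ℤ z) 1 +ℤ x) - (1ℤ +ℤ (1ℤ +ℤ z)) *ℤ 1ℤ) (binom-zeroʳ (1ℤ +ℤ z)) ⟩
  1ℤ *ℤ (binom (1ℤ +ℤ z) 1 +ℤ 1ℤ) - (1ℤ +ℤ (1ℤ +ℤ z)) *ℤ 1ℤ
    ≡⟨ cancel (binom (1ℤ +ℤ z) 1) z ⟩
  1ℤ *ℤ binom (1ℤ +ℤ z) 1 - (1ℤ +ℤ z) *ℤ 1ℤ
    ≡⟨ cong (λ x → 1ℤ *ℤ binom (1ℤ +ℤ z) 1 - (1ℤ +ℤ z) *ℤ x) (binom-zeroʳ z) ⟨
  1ℤ *ℤ binom (1ℤ +ℤ z) 1 - (1ℤ +ℤ z) *ℤ binom z 0 ∎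
  where
  cancel : ∀ x z → 1ℤ *ℤ (x +ℤ 1ℤ) - (1ℤ +ℤ (1ℤ +ℤ z)) *ℤ 1ℤ ≡ 1ℤ *ℤ x - (1ℤ +ℤ z) *ℤ 1ℤ
  cancel = solve-∀
binom-absorb-suc (suc k) z = begin
  (1ℤ +ℤ κ) *ℤ binom (1ℤ +ℤ (1ℤ +ℤ z)) (suc (suc k)) - (1ℤ +ℤ (1ℤ +ℤ z)) *ℤ b₁
    ≡⟨ cong (λ x → (1ℤ +ℤ κ) *ℤ x - (1ℤ +ℤ (1ℤ +ℤ z)) *ℤ b₁) (binom-pascal (1ℤ +ℤ z) (suc k)) ⟩
  (1ℤ +ℤ κ) *ℤ (b₂ +ℤ b₁) - (1ℤ +ℤ (1ℤ +ℤ z)) *ℤ b₁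
    ≡⟨ expand κ z b₁ b₂ ⟩
  (1ℤ +ℤ κ) *ℤ b₂ - (1ℤ +ℤ z) *ℤ b₁ +ℤ κ *ℤ b₁
    ≡⟨ cong₂ (λ x y → (1ℤ +ℤ κ) *ℤ b₂ - (1ℤ +ℤ z) *ℤ x +ℤ y) (binom-pascal z k) (binom-absorb k z) ⟩
  (1ℤ +ℤ κ) *ℤ b₂ - (1ℤ +ℤ z) *ℤ (binom z (suc k) +ℤ binom z k) +ℤ (1ℤ +ℤ z) *ℤ binom z k
    ≡⟨ collect κ z b₂ (binom z (suc k)) (binom z k) ⟩
  (1ℤ +ℤ κ) *ℤ b₂ - (1ℤ +ℤ z) *ℤ binom z (suc k) ∎
  where
  κ = + suc k
  b₁ = binom (1ℤ +ℤ z) (suc k)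
  b₂ = binom (1ℤ +ℤ z) (suc (suc k))
  expand : ∀ κ z b₁ b₂ → (1ℤ +ℤ κ) *ℤ (b₂ +ℤ b₁) - (1ℤ +ℤ (1ℤ +ℤ z)) *ℤ b₁
    ≡ (1ℤ +ℤ κ) *ℤ b₂ - (1ℤ +ℤ z) *ℤ b₁ +ℤ κ *ℤ b₁
  expand = solve-∀
  collect : ∀ κ z b₂ x y → (1ℤ +ℤ κ) *ℤ b₂ - (1ℤ +ℤ z) *ℤ (x +ℤ y) +ℤ (1ℤ +ℤ z) *ℤ y
    ≡ (1ℤ +ℤ κ) *ℤ b₂ - (1ℤ +ℤ z) *ℤ x
  collect = solve-∀

-- (-1)^(j-k) binom (z-k) (j-k), and 0 when k > j.
alt : ℤ → ℕ → ℕ → ℤ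
alt z j       zero    = (-1ℤ ^ j) *ℤ binom z j
alt z zero    (suc k) = 0ℤ
alt z (suc j) (suc k) = alt (z - 1ℤ) j k

alt-≤ : ∀ z {j k} → k ≤ j → alt z j k ≡ (-1ℤ ^ (j ∸ k)) *ℤ binom (z - + k) (j ∸ k)
alt-≤ z {j} z≤n = cong (λ x → (-1ℤ ^ j) *ℤ binom x j) (sym (ℤₚ.+-identityʳ z))
alt-≤ z {suc j} {suc k} (s≤s k≤j) = begin
  alt (z - 1ℤ) j k                                       ≡⟨ alt-≤ (z - 1ℤ) k≤j ⟩
  (-1ℤ ^ (j ∸ k)) *ℤ binom (z - 1ℤ - + k) (j ∸ k)      ≡⟨ cong (λ x → (-1ℤ ^ (j ∸ k)) *ℤ binom x (j ∸ k)) (shift z (+ k)) ⟩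
  (-1ℤ ^ (j ∸ k)) *ℤ binom (z - + suc k) (j ∸ k)        ∎
  where
  shift : ∀ z κ → z - 1ℤ - κ ≡ z - (1ℤ +ℤ κ)
  shift = solve-∀

alt-> : ∀ z {j k} → j < k → alt z j k ≡ 0ℤ
alt-> z {zero}  {suc k} _         = refl
alt-> z {suc j} {suc k} (s≤s j<k) = alt-> (z - 1ℤ) j<k

private
  1+[z-1] : ∀ z → 1ℤ +ℤ (z - 1ℤ) ≡ z
  1+[z-1] = solve-∀

-- The signs (-1)^(j+1) and (-1)^j turn the sum in Pascal's rule into a difference. Lowering `z`,
-- `j` and `k` together reduces to k = 0; the exception is j = 0, k = 1, where the diagonal entries
-- are 1 and the subtracted entry lies above the diagonal.
alt-pascal : ∀ z j k → alt (1ℤ +ℤ z) (suc j) k ≡ alt z (suc j) k - alt z j k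
alt-pascal z j zero = begin
  (-1ℤ *ℤ (-1ℤ ^ j)) *ℤ binom (1ℤ +ℤ z) (suc j)
    ≡⟨ cong ((-1ℤ *ℤ (-1ℤ ^ j)) *ℤ_) (binom-pascal z j) ⟩
  (-1ℤ *ℤ (-1ℤ ^ j)) *ℤ (binom z (suc j) +ℤ binom z j)
    ≡⟨ expand (-1ℤ ^ j) (binom z (suc j)) (binom z j) ⟩
  (-1ℤ *ℤ (-1ℤ ^ j)) *ℤ binom z (suc j) - (-1ℤ ^ j) *ℤ binom z j ∎
  where
  expand : ∀ s x y → -1ℤ *ℤ s *ℤ (x +ℤ y) ≡ -1ℤ *ℤ s *ℤ x - s *ℤ y
  expand = solve-∀
alt-pascal z zero (suc zero) = begin
  1ℤ *ℤ binom (1ℤ +ℤ z - 1ℤ) 0 ≡⟨ cong (1ℤ *ℤ_) (binom-zeroʳ (1ℤ +ℤ z - 1ℤ)) ⟩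
  1ℤ                            ≡⟨ cong (λ x → 1ℤ *ℤ x - 0ℤ) (binom-zeroʳ (z - 1ℤ)) ⟨
  1ℤ *ℤ binom (z - 1ℤ) 0 - 0ℤ  ∎
alt-pascal z zero (suc (suc k)) = refl
alt-pascal z (suc j) (suc k) = begin
  alt (1ℤ +ℤ z - 1ℤ) (suc j) k                  ≡⟨ cong (λ x → alt x (suc j) k) (ℤₚ.+-assoc 1ℤ z -1ℤ) ⟩
  alt (1ℤ +ℤ (z - 1ℤ)) (suc j) k                ≡⟨ alt-pascal (z - 1ℤ) j k ⟩
  alt (z - 1ℤ) (suc j) k - alt (z - 1ℤ) j k     ∎

-- Absorption at the upper argument z - k, with the sign turning z - k into k - z. It accounts for
-- the gap between the factor N+m+1+k produced by the weights and the factor N+m+j+2 demanded by the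
-- recurrence: the surplus j+1-k is traded for a coefficient of x^j.
alt-absorb : ∀ z j k → (+ suc j - + k) *ℤ alt z (suc j) k ≡ (+ k - z) *ℤ alt (z - 1ℤ) j k
alt-absorb z j zero = begin
  (σ - 0ℤ) *ℤ (-1ℤ *ℤ s *ℤ binom z (suc j))     ≡⟨ expand σ s (binom z (suc j)) ⟩
  - s *ℤ (σ *ℤ binom z (suc j))
    ≡⟨ cong (λ x → - s *ℤ (σ *ℤ binom x (suc j))) (1+[z-1] z) ⟨
  - s *ℤ (σ *ℤ binom (1ℤ +ℤ (z - 1ℤ)) (suc j))
    ≡⟨ cong (- s *ℤ_) (binom-absorb j (z - 1ℤ)) ⟩
  - s *ℤ ((1ℤ +ℤ (z - 1ℤ)) *ℤ binom (z - 1ℤ) j) ≡⟨ collect s z (binom (z - 1ℤ) j) ⟩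
  (0ℤ - z) *ℤ (s *ℤ binom (z - 1ℤ) j)           ∎
  where
  σ = + suc j
  s = -1ℤ ^ j
  expand : ∀ σ s x → (σ - 0ℤ) *ℤ (-1ℤ *ℤ s *ℤ x) ≡ - s *ℤ (σ *ℤ x)
  expand = solve-∀
  collect : ∀ s z x → - s *ℤ ((1ℤ +ℤ (z - 1ℤ)) *ℤ x) ≡ (0ℤ - z) *ℤ (s *ℤ x)
  collect = solve-∀
alt-absorb z zero (suc zero)    = sym (ℤₚ.*-zeroʳ (+ 1 - z))
alt-absorb z zero (suc (suc k)) = trans (ℤₚ.*-zeroʳ (+ 1 - + suc (suc k))) (sym (ℤₚ.*-zeroʳ (+ suc (suc k) - z)))
alt-absorb z (suc j) (suc k) = begin
  (1ℤ +ℤ + suc j - (1ℤ +ℤ + k)) *ℤ alt (z - 1ℤ) (suc j) k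
    ≡⟨ cong (_*ℤ alt (z - 1ℤ) (suc j) k) (cancel (+ suc j) (+ k)) ⟩
  (+ suc j - + k) *ℤ alt (z - 1ℤ) (suc j) k       ≡⟨ alt-absorb (z - 1ℤ) j k ⟩
  (+ k - (z - 1ℤ)) *ℤ alt (z - 1ℤ - 1ℤ) j k       ≡⟨ cong (_*ℤ alt (z - 1ℤ - 1ℤ) j k) (shift z (+ k)) ⟩
  (1ℤ +ℤ + k - z) *ℤ alt (z - 1ℤ - 1ℤ) j k        ∎
  where
  cancel : ∀ σ κ → 1ℤ +ℤ σ - (1ℤ +ℤ κ) ≡ σ - κ
  cancel = solve-∀
  shift : ∀ z κ → κ - (z - 1ℤ) ≡ 1ℤ +ℤ κ - z
  shift = solve-∀

-- Products and weights

range-∷ʳ : ∀ {a b} → a ≤ suc b → range a (suc b) ≡ range a b ∷ʳ suc b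
range-∷ʳ {a} {b} a≤1+b = begin
  applyUpTo (λ i → a + i) (suc (suc b) ∸ a)            ≡⟨ cong (applyUpTo (λ i → a + i)) (ℕₚ.+-∸-assoc 1 a≤1+b) ⟩
  applyUpTo (λ i → a + i) (suc (suc b ∸ a))            ≡⟨ applyUpTo-∷ʳ (λ i → a + i) (suc b ∸ a) ⟨
  range a b ∷ʳ (a + (suc b ∸ a))                ≡⟨ cong (range a b ∷ʳ_) (ℕₚ.m+[n∸m]≡n a≤1+b) ⟩
  range a b ∷ʳ suc b                            ∎

∏-last : ∀ f {a b} → a ≤ suc b → ∏ a (suc b) f ≡ ∏ a b f * f (suc b)
∏-last f {a} {b} a≤1+b = begin
  product (map f (range a (suc b)))             ≡⟨ cong (λ r → product (map f r)) (range-∷ʳ a≤1+b) ⟩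
  product (map f (range a b ∷ʳ suc b))          ≡⟨ cong product (map-++ f (range a b) [ suc b ]) ⟩
  product (map f (range a b) ∷ʳ f (suc b))      ≡⟨ product-++ (map f (range a b)) [ f (suc b) ] ⟩
  ∏ a b f * (f (suc b) * 1)                     ≡⟨ cong (∏ a b f *_) (ℕₚ.*-identityʳ (f (suc b))) ⟩
  ∏ a b f * f (suc b)                           ∎

∏-empty : ∀ f b → ∏ (suc b) b f ≡ 1
∏-empty f b = cong (λ d → product (map f (applyUpTo (λ i → suc b + i) d))) (ℕₚ.n∸n≡0 (suc b))

∏-head : ∀ f a d → ∏ (suc a) (suc a + d) f ≡ f (suc a) * ∏ (suc (suc a)) (suc a + d) f
∏-head f a zero = begin
  ∏ (suc a) (suc a + 0) f                             ≡⟨ cong (λ b → ∏ (suc a) b f) (ℕₚ.+-identityʳ (suc a)) ⟩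
  ∏ (suc a) (suc a) f                                 ≡⟨ ∏-last f {suc a} {a} ℕₚ.≤-refl ⟩
  ∏ (suc a) a f * f (suc a)                           ≡⟨ cong (_* f (suc a)) (∏-empty f a) ⟩
  1 * f (suc a)                                       ≡⟨ ℕₚ.*-comm 1 (f (suc a)) ⟩
  f (suc a) * 1                                       ≡⟨ cong (f (suc a) *_) (∏-empty f (suc a)) ⟨
  f (suc a) * ∏ (suc (suc a)) (suc a) f               ≡⟨ cong (λ b → f (suc a) * ∏ (suc (suc a)) b f) (ℕₚ.+-identityʳ (suc a)) ⟨
  f (suc a) * ∏ (suc (suc a)) (suc a + 0) f           ∎
∏-head f a (suc d) rewrite ℕₚ.+-suc a d = begin
  ∏ (suc a) (suc e) f                                 ≡⟨ ∏-last f (s≤s (ℕₚ.≤-trans (ℕₚ.m≤m+n a d) (ℕₚ.n≤1+n (a + d)))) ⟩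
  ∏ (suc a) e f * f (suc e)                           ≡⟨ cong (_* f (suc e)) (∏-head f a d) ⟩
  f (suc a) * ∏ (suc (suc a)) e f * f (suc e)         ≡⟨ ℕₚ.*-assoc (f (suc a)) _ _ ⟩
  f (suc a) * (∏ (suc (suc a)) e f * f (suc e))       ≡⟨ cong (f (suc a) *_) (∏-last f (s≤s (s≤s (ℕₚ.m≤m+n a d)))) ⟨
  f (suc a) * ∏ (suc (suc a)) (suc e) f               ∎
  where e = suc a + d

-- `_↓_` branches on `k ≤ᵇ n`; the recursion along `k` becomes visible only in `_P′_`.
↓≡P′ : ∀ {n k} → k ≤ n → n ↓ k ≡ n P′ k
↓≡P′ {n} {k} k≤n with k ≤ᵇ n in eq
... | true  = refl
... | false with () ← subst T eq (ℕₚ.≤⇒≤ᵇ k≤n)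

↓-suc : ∀ n k → n ↓ suc k ≡ (n ∸ k) * (n ↓ k)
↓-suc n k with ℕₚ.<-cmp k n
... | tri< k<n _ _ = trans (↓≡P′ k<n) (cong ((n ∸ k) *_) (sym (↓≡P′ (ℕₚ.<⇒≤ k<n))))
... | tri≈ _ refl _ = trans (k>n⇒nPk≡0 (ℕₚ.n<1+n n)) (cong (_* (n ↓ n)) (sym (ℕₚ.n∸n≡0 n)))
... | tri> _ _ k>n = trans (k>n⇒nPk≡0 (ℕₚ.m<n⇒m<1+n k>n))
  (sym (trans (cong ((n ∸ k) *_) (k>n⇒nPk≡0 k>n)) (ℕₚ.*-zeroʳ (n ∸ k))))

suc-↓-suc : ∀ n k → suc n ↓ suc k ≡ suc n * (n ↓ k)
suc-↓-suc n zero    = trans (nP1≡n (suc n)) (sym (ℕₚ.*-identityʳ (suc n)))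
suc-↓-suc n (suc k) = begin
  suc n ↓ suc (suc k)           ≡⟨ ↓-suc (suc n) (suc k) ⟩
  (n ∸ k) * (suc n ↓ suc k)     ≡⟨ cong ((n ∸ k) *_) (suc-↓-suc n k) ⟩
  (n ∸ k) * (suc n * (n ↓ k))   ≡⟨ swap (n ∸ k) (suc n) (n ↓ k) ⟩
  suc n * ((n ∸ k) * (n ↓ k))   ≡⟨ cong (suc n *_) (↓-suc n k) ⟨
  suc n * (n ↓ suc k)           ∎
  where
  swap : ∀ x y z → x * (y * z) ≡ y * (x * z)
  swap = ℕ-Ring.solve-∀

weight : ℕ → ℕ → ℕ → ℕ
weight N m k = (m ↓ k) * (∏[ l from k + 1 to m ] (N + l))

weight-0 : ∀ N m → weight N m 0 ≡ (∏[ l from 1 to m ] (N + l))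
weight-0 N m = ℕₚ.+-identityʳ _

weight-> : ∀ N {m k} → m < k → weight N m k ≡ 0
weight-> N {m} {k} m<k = cong (_* (∏[ l from k + 1 to m ] (N + l))) (k>n⇒nPk≡0 m<k)

weight-suc-0 : ∀ N m → weight N (suc m) 0 ≡ (N + suc m) * weight N m 0
weight-suc-0 N m = begin
  weight N (suc m) 0                            ≡⟨ weight-0 N (suc m) ⟩
  ∏[ l from 1 to suc m ] (N + l)                ≡⟨ ∏-last (λ l → N + l) {1} {m} (s≤s z≤n) ⟩
  (∏[ l from 1 to m ] (N + l)) * (N + suc m)    ≡⟨ ℕₚ.*-comm _ (N + suc m) ⟩
  (N + suc m) * (∏[ l from 1 to m ] (N + l))    ≡⟨ cong ((N + suc m) *_) (weight-0 N m) ⟨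
  (N + suc m) * weight N m 0                    ∎

-- For k < m all terms share the factor (m)_k ∏_{k+2≤l≤m} (N+l), and what remains is (m+1)(N+m+1) =
-- (N+m+k+2)(m-k) + (k+1)(N+k+1). For k = m the weight W(m,k+1) vanishes and only the last term
-- survives; for k > m all three weights are zero.
weight-suc-suc : ∀ N m k →
  weight N (suc m) (suc k) ≡ (N + suc m + suc k) * weight N m (suc k) + suc k * weight N m k
weight-suc-suc N m k with ℕₚ.<-cmp k m
... | tri> _ _ k>m = trans (weight-> N (s≤s k>m)) (sym (begin
  (N + suc m + suc k) * weight N m (suc k) + suc k * weight N m k
    ≡⟨ cong₂ (λ x y → (N + suc m + suc k) * x + suc k * y) (weight-> N (ℕₚ.m<n⇒m<1+n k>m)) (weight-> N k>m) ⟩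
  (N + suc m + suc k) * 0 + suc k * 0
    ≡⟨ cong₂ _+_ (ℕₚ.*-zeroʳ (N + suc m + suc k)) (ℕₚ.*-zeroʳ (suc k)) ⟩
  0 ∎))
... | tri≈ _ refl _ = begin
  (suc k ↓ suc k) * ∏ (suc k + 1) (suc k) (λ l → N + l)
    ≡⟨ cong₂ _*_ (suc-↓-suc k k) (empty (suc k)) ⟩
  suc k * (k ↓ k) * 1
    ≡⟨ ℕₚ.*-assoc (suc k) (k ↓ k) 1 ⟩
  suc k * ((k ↓ k) * 1)
    ≡⟨ cong₂ (λ x y → x + suc k * ((k ↓ k) * y)) (ℕₚ.*-zeroʳ (N + suc k + suc k)) (empty k) ⟨
  (N + suc k + suc k) * 0 + suc k * weight N k k
    ≡⟨ cong (λ x → (N + suc k + suc k) * x + suc k * weight N k k) (weight-> N (ℕₚ.n<1+n k)) ⟨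
  (N + suc k + suc k) * weight N k (suc k) + suc k * weight N k k ∎
  where
  empty : ∀ b → ∏ (b + 1) b (λ l → N + l) ≡ 1
  empty b = trans (cong (λ a → ∏ a b (λ l → N + l)) (ℕₚ.+-comm b 1)) (∏-empty (λ l → N + l) b)
... | tri< k<m _ _ with d , refl ← ℕₚ.m≤n⇒∃[o]m+o≡n k<m = begin
  (suc m ↓ suc k) * ∏ (suc k + 1) (suc m) f
    ≡⟨ cong₂ _*_ (suc-↓-suc m k)
         (trans (cong (λ a → ∏ a (suc m) f) (ℕₚ.+-comm (suc k) 1)) (∏-last f (s≤s (s≤s (ℕₚ.m≤m+n k d))))) ⟩
  (suc m * p) * (g * (N + suc m))
    ≡⟨ identity N k d p g ⟩
  (N + suc m + suc k) * ((suc d * p) * g) + suc k * (p * ((N + suc k) * g))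
    ≡⟨ cong₂ (λ x y → (N + suc m + suc k) * (x * g) + suc k * (p * y)) (trans (↓-suc m k) (cong (_* p) m∸k)) (∏-head f k d) ⟨
  (N + suc m + suc k) * ((m ↓ suc k) * g) + suc k * (p * ∏ (suc k) m f)
    ≡⟨ cong₂ (λ a a′ → (N + suc m + suc k) * ((m ↓ suc k) * ∏ a m f) + suc k * (p * ∏ a′ m f))
         (ℕₚ.+-comm (suc k) 1) (ℕₚ.+-comm k 1) ⟨
  (N + suc m + suc k) * weight N m (suc k) + suc k * weight N m k ∎
  where
  f = λ l → N + l
  p = m ↓ k
  g = ∏ (suc (suc k)) m f
  m∸k : m ∸ k ≡ suc d
  m∸k = trans (cong (_∸ k) (sym (ℕₚ.+-suc k d))) (ℕₚ.m+n∸m≡n k (suc d))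
  identity : ∀ N k d p g → ((2 + k + d) * p) * (g * (N + (2 + k + d)))
    ≡ (N + (2 + k + d) + (1 + k)) * ((1 + d) * p * g) + (1 + k) * (p * ((N + (1 + k)) * g))
  identity = ℕ-Ring.solve-∀

-- Closed forms of the coefficients

sum : ℕ → (ℕ → ℤ) → ℤ
sum zero    f = 0ℤ
sum (suc n) f = sum n f +ℤ f n

sum-cong : ∀ n {f g} → (∀ k → k < n → f k ≡ g k) → sum n f ≡ sum n g
sum-cong zero    f≗g = refl
sum-cong (suc n) f≗g = cong₂ _+ℤ_ (sum-cong n λ k k<n → f≗g k (ℕₚ.m<n⇒m<1+n k<n)) (f≗g n ℕₚ.≤-refl)

sum-zero : ∀ n {f} → (∀ k → k < n → f k ≡ 0ℤ) → sum n f ≡ 0ℤ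
sum-zero zero    f≗0 = refl
sum-zero (suc n) f≗0 = cong₂ _+ℤ_ (sum-zero n λ k k<n → f≗0 k (ℕₚ.m<n⇒m<1+n k<n)) (f≗0 n ℕₚ.≤-refl)

sum-extend : ∀ n f → f n ≡ 0ℤ → sum (suc n) f ≡ sum n f
sum-extend n f fn≡0 = trans (cong (sum n f +ℤ_) fn≡0) (ℤₚ.+-identityʳ (sum n f))

-- Meant for identities that hold termwise only up to a difference of consecutive values of `v`.
-- Pascal's rule for the Q coefficients is the case where `v` is zero; the even-index identity needs
-- a genuine `v`.
sum-linear-telescope : ∀ n x y (f g h v : ℕ → ℤ) →
  (∀ k → f k ≡ x *ℤ g k +ℤ y *ℤ h k +ℤ (v k - v (suc k))) →
  sum n f ≡ x *ℤ sum n g +ℤ y *ℤ sum n h +ℤ (v 0 - v n)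
sum-linear-telescope zero x y f g h v eq = lemma x y (v 0)
  where
  lemma : ∀ x y v → 0ℤ ≡ x *ℤ 0ℤ +ℤ y *ℤ 0ℤ +ℤ (v - v)
  lemma = solve-∀
sum-linear-telescope (suc n) x y f g h v eq = begin
  sum n f +ℤ f n
    ≡⟨ cong₂ _+ℤ_ (sum-linear-telescope n x y f g h v eq) (eq n) ⟩
  (x *ℤ sum n g +ℤ y *ℤ sum n h +ℤ (v 0 - v n)) +ℤ (x *ℤ g n +ℤ y *ℤ h n +ℤ (v n - v (suc n)))
    ≡⟨ lemma x y (sum n g) (sum n h) (g n) (h n) (v 0) (v n) (v (suc n)) ⟩
  x *ℤ (sum n g +ℤ g n) +ℤ y *ℤ (sum n h +ℤ h n) +ℤ (v 0 - v (suc n)) ∎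
  where
  lemma : ∀ x y G H g h v₀ v₁ v₂ →
    (x *ℤ G +ℤ y *ℤ H +ℤ (v₀ - v₁)) +ℤ (x *ℤ g +ℤ y *ℤ h +ℤ (v₁ - v₂))
      ≡ x *ℤ (G +ℤ g) +ℤ y *ℤ (H +ℤ h) +ℤ (v₀ - v₂)
  lemma = solve-∀

-- S c m j stands for the coefficient of x^j in the polynomial of index m + j, c being half
-- that index rounded up.
record IsClosedForm (N : ℕ) (S : ℕ → ℕ → ℕ → ℤ) : Set where
  field
    pascal-0 : ∀ c m → S (suc c) m 0 ≡ S c m 0
    pascal   : ∀ c m j → S (suc c) m (suc j) ≡ S c m (suc j) - S c m j
    step-0   : ∀ c m → S c (suc m) 0 ≡ + (N + suc m) *ℤ S c m 0
    step     : ∀ c m j → S (suc c) (suc m) (suc j)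
                 ≡ + (N + suc m + suc j) *ℤ S (suc c) m (suc j) +ℤ + suc c *ℤ S c m j
    vanish   : ∀ c j → suc c < j → S (suc c) 0 j ≡ 0ℤ

P-coeff : ℕ → ℕ → ℕ → ℕ → ℤ
P-coeff N c m j = (-1ℤ ^ j) *ℤ binom (+ c) j *ℤ + (∏[ l from 1 to m ] (N + l))

P-coeff-vanish : ∀ N c m j → c < j → P-coeff N c m j ≡ 0ℤ
P-coeff-vanish N c m j c<j = begin
  (-1ℤ ^ j) *ℤ + (c C j) *ℤ + p ≡⟨ cong (λ x → (-1ℤ ^ j) *ℤ + x *ℤ + p) (k>n⇒nCk≡0 c<j) ⟩
  (-1ℤ ^ j) *ℤ 0ℤ *ℤ + p        ≡⟨ cong (_*ℤ + p) (ℤₚ.*-zeroʳ (-1ℤ ^ j)) ⟩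
  0ℤ                             ∎
  where p = ∏[ l from 1 to m ] (N + l)

-- Up to computation `P-coeff N c m j` is `alt (+ c) j 0` times the product, so the rules for `alt`
-- at k = 0 apply. Passing to m + 1 multiplies the product by N+m+1 = (N+m+j+2) - (j+1), and
-- absorbing j+1 into the binomial produces the term with c + 1.
P-coeff-isClosedForm : ∀ N → IsClosedForm N (P-coeff N)
P-coeff-isClosedForm N = record
  { pascal-0 = λ c m → refl
  ; pascal   = λ c m j → begin
      alt (1ℤ +ℤ + c) (suc j) 0 *ℤ + F m
        ≡⟨ cong (_*ℤ + F m) (alt-pascal (+ c) j 0) ⟩
      (alt (+ c) (suc j) 0 - alt (+ c) j 0) *ℤ + F m
        ≡⟨ ℤₚ.*-distribʳ-+ (+ F m) (alt (+ c) (suc j) 0) (- alt (+ c) j 0) ⟩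
      P-coeff N c m (suc j) +ℤ - alt (+ c) j 0 *ℤ + F m
        ≡⟨ cong (P-coeff N c m (suc j) +ℤ_) (ℤₚ.neg-distribˡ-* (alt (+ c) j 0) (+ F m)) ⟨
      P-coeff N c m (suc j) - P-coeff N c m j ∎
  ; step-0   = λ c m → trans (cong (1ℤ *ℤ 1ℤ *ℤ_) (F-suc m)) (swap 1ℤ (+ (N + suc m)) (+ F m))
  ; step     = λ c m j → begin
      alt (+ suc c) (suc j) 0 *ℤ + F (suc m)
        ≡⟨ cong (alt (+ suc c) (suc j) 0 *ℤ_) (F-suc m) ⟩
      alt (+ suc c) (suc j) 0 *ℤ (+ (N + suc m) *ℤ + F m)
        ≡⟨ expand (alt (+ suc c) (suc j) 0) (+ (N + suc m)) (+ suc j) (+ F m) ⟩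
      (+ (N + suc m) +ℤ + suc j) *ℤ P-coeff N (suc c) m (suc j) - (+ suc j - + 0) *ℤ alt (+ suc c) (suc j) 0 *ℤ + F m
        ≡⟨ cong₂ (λ x y → x *ℤ P-coeff N (suc c) m (suc j) - y *ℤ + F m)
             (sym (pos-+ (N + suc m) (suc j))) (alt-absorb (+ suc c) j 0) ⟩
      + (N + suc m + suc j) *ℤ P-coeff N (suc c) m (suc j) - (+ 0 - + suc c) *ℤ alt (+ c) j 0 *ℤ + F m
        ≡⟨ collect (+ (N + suc m + suc j) *ℤ P-coeff N (suc c) m (suc j)) (+ suc c) (alt (+ c) j 0) (+ F m) ⟩
      + (N + suc m + suc j) *ℤ P-coeff N (suc c) m (suc j) +ℤ + suc c *ℤ P-coeff N c m j ∎
  ; vanish   = λ c j → P-coeff-vanish N (suc c) 0 j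
  }
  where
  F : ℕ → ℕ
  F m = ∏[ l from 1 to m ] (N + l)
  F-suc : ∀ m → + F (suc m) ≡ + (N + suc m) *ℤ + F m
  F-suc m = begin
    + F (suc m)                   ≡⟨ cong +_ (∏-last (λ l → N + l) {1} {m} (s≤s z≤n)) ⟩
    + (F m * (N + suc m))         ≡⟨ cong +_ (ℕₚ.*-comm (F m) (N + suc m)) ⟩
    + ((N + suc m) * F m)         ≡⟨ pos-* (N + suc m) (F m) ⟩
    + (N + suc m) *ℤ + F m        ∎
  swap : ∀ s x y → s *ℤ (x *ℤ y) ≡ x *ℤ (s *ℤ y)
  swap = solve-∀
  expand : ∀ κ x σ y → κ *ℤ (x *ℤ y) ≡ (x +ℤ σ) *ℤ (κ *ℤ y) - (σ - + 0) *ℤ κ *ℤ y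
  expand = solve-∀
  collect : ∀ x γ κ y → x - (+ 0 - γ) *ℤ κ *ℤ y ≡ x +ℤ γ *ℤ (κ *ℤ y)
  collect = solve-∀

Q-coeff : ℕ → ℕ → ℕ → ℕ → ℤ
Q-coeff N c m j = sum (suc j) λ k → alt (+ c - 1ℤ) j k *ℤ + weight N m k

-- The added entry lies above the diagonal of `alt`. This lets the sums belonging to j and to j + 1
-- run over the same k, so that they can be compared term by term.
Q-coeff-extend : ∀ N c m j →
  sum (suc (suc j)) (λ k → alt (+ c - 1ℤ) j k *ℤ + weight N m k) ≡ Q-coeff N c m j
Q-coeff-extend N c m j = sum-extend (suc j) _ (cong (_*ℤ + weight N m (suc j)) (alt-> (+ c - 1ℤ) (ℕₚ.n<1+n j)))

Q-coeff-pascal : ∀ N c m j → Q-coeff N (suc c) m (suc j) ≡ Q-coeff N c m (suc j) - Q-coeff N c m j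
Q-coeff-pascal N c m j = begin
  Q-coeff N (suc c) m (suc j)
    ≡⟨ sum-linear-telescope (suc (suc j)) 1ℤ -1ℤ _ _ (λ k → alt (+ c - 1ℤ) j k *ℤ w k) (λ _ → 0ℤ) term ⟩
  1ℤ *ℤ Q-coeff N c m (suc j) +ℤ -1ℤ *ℤ sum (suc (suc j)) (λ k → alt (+ c - 1ℤ) j k *ℤ w k) +ℤ 0ℤ
    ≡⟨ cong (λ x → 1ℤ *ℤ Q-coeff N c m (suc j) +ℤ -1ℤ *ℤ x +ℤ 0ℤ) (Q-coeff-extend N c m j) ⟩
  1ℤ *ℤ Q-coeff N c m (suc j) +ℤ -1ℤ *ℤ Q-coeff N c m j +ℤ 0ℤ
    ≡⟨ collect (Q-coeff N c m (suc j)) (Q-coeff N c m j) ⟩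
  Q-coeff N c m (suc j) - Q-coeff N c m j ∎
  where
  w = λ k → + weight N m k
  collect : ∀ x y → 1ℤ *ℤ x +ℤ -1ℤ *ℤ y +ℤ 0ℤ ≡ x - y
  collect = solve-∀
  expand : ∀ x y w → (x - y) *ℤ w ≡ 1ℤ *ℤ (x *ℤ w) +ℤ -1ℤ *ℤ (y *ℤ w) +ℤ (0ℤ - 0ℤ)
  expand = solve-∀
  term : ∀ k → alt (+ c) (suc j) k *ℤ w k
    ≡ 1ℤ *ℤ (alt (+ c - 1ℤ) (suc j) k *ℤ w k) +ℤ -1ℤ *ℤ (alt (+ c - 1ℤ) j k *ℤ w k) +ℤ (0ℤ - 0ℤ)
  term k = begin
    alt (+ c) (suc j) k *ℤ w k
      ≡⟨ cong (λ z → alt z (suc j) k *ℤ w k) (sym (1+[z-1] (+ c))) ⟩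
    alt (1ℤ +ℤ (+ c - 1ℤ)) (suc j) k *ℤ w k
      ≡⟨ cong (_*ℤ w k) (alt-pascal (+ c - 1ℤ) j k) ⟩
    (alt (+ c - 1ℤ) (suc j) k - alt (+ c - 1ℤ) j k) *ℤ w k
      ≡⟨ expand (alt (+ c - 1ℤ) (suc j) k) (alt (+ c - 1ℤ) j k) (w k) ⟩
    _ ∎

Q-coeff-step : ∀ N c m j → Q-coeff N (suc c) (suc m) (suc j)
  ≡ + (N + suc m + suc j) *ℤ Q-coeff N (suc c) m (suc j) +ℤ + suc c *ℤ Q-coeff N c m j
Q-coeff-step N c m j = begin
  Q-coeff N (suc c) (suc m) (suc j)
    ≡⟨ sum-linear-telescope (suc (suc j)) A (+ suc c) _ _ (λ k → κ′ k *ℤ w k) v term ⟩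
  A *ℤ Q-coeff N (suc c) m (suc j) +ℤ + suc c *ℤ sum (suc (suc j)) (λ k → κ′ k *ℤ w k) +ℤ (v 0 - v (suc (suc j)))
    ≡⟨ cong₂ (λ x y → A *ℤ Q-coeff N (suc c) m (suc j) +ℤ + suc c *ℤ x +ℤ y) (Q-coeff-extend N c m j) boundary ⟩
  A *ℤ Q-coeff N (suc c) m (suc j) +ℤ + suc c *ℤ Q-coeff N c m j +ℤ 0ℤ
    ≡⟨ ℤₚ.+-identityʳ _ ⟩
  A *ℤ Q-coeff N (suc c) m (suc j) +ℤ + suc c *ℤ Q-coeff N c m j ∎
  where
  A = + (N + suc m + suc j)
  w κ κ′ v : ℕ → ℤ
  lower : ℕ → ℕ
  w k  = + weight N m k
  κ k  = alt (+ c) (suc j) k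
  κ′ k = alt (+ c - 1ℤ) j k
  lower zero    = 0
  lower (suc k) = suc k * weight N m k
  -- Absorption leaves (c-k) `κ′ k` W(m,k), that is, the wanted multiple c+1 minus `κ′ k` (k+1)
  -- W(m,k). Since `κ (suc k)` computes to `κ′ k`, this excess is `v (suc k)`, whereas `v k` comes
  -- from the expansion of W(m+1,k). At the ends, `lower 0` is 0 and `κ` vanishes beyond j + 1.
  v k = κ k *ℤ + lower k

  weight-suc : ∀ k → weight N (suc m) k ≡ (N + suc m + k) * weight N m k + lower k
  weight-suc zero    = trans (weight-suc-0 N m)
    (trans (cong (_* weight N m 0) (sym (ℕₚ.+-identityʳ (N + suc m)))) (sym (ℕₚ.+-identityʳ _)))
  weight-suc (suc k) = weight-suc-suc N m k

  +weight-suc : ∀ k → + weight N (suc m) k ≡ (+ (N + suc m) +ℤ + k) *ℤ w k +ℤ + lower k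
  +weight-suc k = begin
    + weight N (suc m) k                                   ≡⟨ cong +_ (weight-suc k) ⟩
    + ((N + suc m + k) * weight N m k + lower k)           ≡⟨ pos-+ ((N + suc m + k) * weight N m k) (lower k) ⟩
    + ((N + suc m + k) * weight N m k) +ℤ + lower k        ≡⟨ cong (_+ℤ + lower k) (pos-* (N + suc m + k) (weight N m k)) ⟩
    + (N + suc m + k) *ℤ w k +ℤ + lower k                  ≡⟨ cong (λ x → x *ℤ w k +ℤ + lower k) (pos-+ (N + suc m) k) ⟩
    (+ (N + suc m) +ℤ + k) *ℤ w k +ℤ + lower k             ∎

  boundary : v 0 - v (suc (suc j)) ≡ 0ℤ
  boundary = cong₂ (λ x y → x - y *ℤ + lower (suc (suc j))) (ℤₚ.*-zeroʳ (κ 0)) (alt-> (+ c) (ℕₚ.n<1+n (suc j)))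

  expand : ∀ κ b k σ w l → κ *ℤ ((b +ℤ k) *ℤ w +ℤ l) ≡ (b +ℤ σ) *ℤ (κ *ℤ w) - (σ - k) *ℤ κ *ℤ w +ℤ κ *ℤ l
  expand = solve-∀
  collect : ∀ x κ′ k γ w y → x - (k - γ) *ℤ κ′ *ℤ w +ℤ y ≡ x +ℤ (1ℤ +ℤ γ) *ℤ (κ′ *ℤ w) +ℤ (y - κ′ *ℤ ((1ℤ +ℤ k) *ℤ w))
  collect = solve-∀

  term : ∀ k → κ k *ℤ + weight N (suc m) k
    ≡ A *ℤ (κ k *ℤ w k) +ℤ + suc c *ℤ (κ′ k *ℤ w k) +ℤ (v k - v (suc k))
  term k = begin
    κ k *ℤ + weight N (suc m) k
      ≡⟨ cong (κ k *ℤ_) (+weight-suc k) ⟩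
    κ k *ℤ ((+ (N + suc m) +ℤ + k) *ℤ w k +ℤ + lower k)
      ≡⟨ expand (κ k) (+ (N + suc m)) (+ k) (+ suc j) (w k) (+ lower k) ⟩
    (+ (N + suc m) +ℤ + suc j) *ℤ (κ k *ℤ w k) - (+ suc j - + k) *ℤ κ k *ℤ w k +ℤ v k
      ≡⟨ cong₂ (λ x y → x *ℤ (κ k *ℤ w k) - y *ℤ w k +ℤ v k) (sym (pos-+ (N + suc m) (suc j))) (alt-absorb (+ c) j k) ⟩
    A *ℤ (κ k *ℤ w k) - (+ k - + c) *ℤ κ′ k *ℤ w k +ℤ v k
      ≡⟨ collect (A *ℤ (κ k *ℤ w k)) (κ′ k) (+ k) (+ c) (w k) (v k) ⟩
    A *ℤ (κ k *ℤ w k) +ℤ + suc c *ℤ (κ′ k *ℤ w k) +ℤ (v k - κ′ k *ℤ (+ suc k *ℤ w k))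
      ≡⟨ cong (λ x → A *ℤ (κ k *ℤ w k) +ℤ + suc c *ℤ (κ′ k *ℤ w k) +ℤ (v k - κ′ k *ℤ x)) (pos-* (suc k) (weight N m k)) ⟨
    A *ℤ (κ k *ℤ w k) +ℤ + suc c *ℤ (κ′ k *ℤ w k) +ℤ (v k - v (suc k)) ∎

-- Terms with k > m have weight zero. For k ≤ m < c the upper argument c - 1 - k is a natural
-- number, and c ≤ j makes it smaller than j - k. The bound m < c thus keeps out negative upper
-- arguments, at which the binomial would not vanish.
Q-coeff-vanish : ∀ N c m j → m < c → c ≤ j → Q-coeff N c m j ≡ 0ℤ
Q-coeff-vanish N (suc c) m j (s≤s m≤c) c<j = sum-zero (suc j) term
  where
  term : ∀ k → k < suc j → alt (+ c) j k *ℤ + weight N m k ≡ 0ℤ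
  term k (s≤s k≤j) with ℕₚ.≤-<-connex k m
  ... | inj₂ m<k = trans (cong (λ x → alt (+ c) j k *ℤ + x) (weight-> N m<k)) (ℤₚ.*-zeroʳ (alt (+ c) j k))
  ... | inj₁ k≤m = cong (_*ℤ + weight N m k) (begin
    alt (+ c) j k                                       ≡⟨ alt-≤ (+ c) k≤j ⟩
    (-1ℤ ^ (j ∸ k)) *ℤ binom (+ c - + k) (j ∸ k)
      ≡⟨ cong (λ z → (-1ℤ ^ (j ∸ k)) *ℤ binom z (j ∸ k)) (trans (ℤₚ.m-n≡m⊖n c k) (ℤₚ.⊖-≥ k≤c)) ⟩
    (-1ℤ ^ (j ∸ k)) *ℤ + ((c ∸ k) C (j ∸ k))
      ≡⟨ cong (λ x → (-1ℤ ^ (j ∸ k)) *ℤ + x) (k>n⇒nCk≡0 (ℕₚ.∸-monoˡ-< c<j k≤c)) ⟩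
    (-1ℤ ^ (j ∸ k)) *ℤ 0ℤ                               ≡⟨ ℤₚ.*-zeroʳ (-1ℤ ^ (j ∸ k)) ⟩
    0ℤ                                                  ∎)
    where k≤c = ℕₚ.≤-trans k≤m m≤c

Q-coeff-0 : ∀ N c m → Q-coeff N c m 0 ≡ + weight N m 0
Q-coeff-0 N c m = trans (ℤₚ.+-identityˡ _)
  (trans (cong (λ x → 1ℤ *ℤ x *ℤ + weight N m 0) (binom-zeroʳ (+ c - 1ℤ))) (ℤₚ.*-identityˡ (+ weight N m 0)))

Q-coeff-isClosedForm : ∀ N → IsClosedForm N (Q-coeff N)
Q-coeff-isClosedForm N = record
  { pascal-0 = λ c m → trans (Q-coeff-0 N (suc c) m) (sym (Q-coeff-0 N c m))
  ; pascal   = Q-coeff-pascal N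
  ; step-0   = λ c m → begin
      Q-coeff N c (suc m) 0                     ≡⟨ Q-coeff-0 N c (suc m) ⟩
      + weight N (suc m) 0                  ≡⟨ cong +_ (weight-suc-0 N m) ⟩
      + ((N + suc m) * weight N m 0)        ≡⟨ pos-* (N + suc m) (weight N m 0) ⟩
      + (N + suc m) *ℤ + weight N m 0       ≡⟨ cong (+ (N + suc m) *ℤ_) (Q-coeff-0 N c m) ⟨
      + (N + suc m) *ℤ Q-coeff N c m 0          ∎
  ; step     = Q-coeff-step N
  ; vanish   = λ c j c<j → Q-coeff-vanish N (suc c) 0 j (s≤s z≤n) (ℕₚ.<⇒≤ c<j)
  }

-- Coefficients of polynomials

coeff-⊕ : ∀ p q i → coeff (p ⊕ q) i ≡ coeff p i +ℤ coeff q i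
coeff-⊕ []      q       i       = sym (ℤₚ.+-identityˡ (coeff q i))
coeff-⊕ (x ∷ p) []      i       = sym (ℤₚ.+-identityʳ (coeff (x ∷ p) i))
coeff-⊕ (x ∷ p) (y ∷ q) zero    = refl
coeff-⊕ (x ∷ p) (y ∷ q) (suc i) = coeff-⊕ p q i

coeff-· : ∀ c p i → coeff (c · p) i ≡ c *ℤ coeff p i
coeff-· c []      i       = sym (ℤₚ.*-zeroʳ c)
coeff-· c (x ∷ p) zero    = refl
coeff-· c (x ∷ p) (suc i) = coeff-· c p i

coeff-[0] : ∀ i → coeff (0ℤ ∷ []) i ≡ 0ℤ
coeff-[0] zero    = refl
coeff-[0] (suc i) = refl

coeff-const-⊗ : ∀ c p i → coeff (const c ⊗ p) i ≡ c *ℤ coeff p i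
coeff-const-⊗ c p i = begin
  coeff ((c · p) ⊕ (0ℤ ∷ [])) i             ≡⟨ coeff-⊕ (c · p) (0ℤ ∷ []) i ⟩
  coeff (c · p) i +ℤ coeff (0ℤ ∷ []) i      ≡⟨ cong₂ _+ℤ_ (coeff-· c p i) (coeff-[0] i) ⟩
  c *ℤ coeff p i +ℤ 0ℤ                      ≡⟨ ℤₚ.+-identityʳ _ ⟩
  c *ℤ coeff p i                            ∎

coeff-linear-⊗-0 : ∀ c d p → coeff ((c ∷ d ∷ []) ⊗ p) 0 ≡ c *ℤ coeff p 0
coeff-linear-⊗-0 c d p = begin
  coeff ((c · p) ⊕ (0ℤ ∷ (const d ⊗ p))) 0    ≡⟨ coeff-⊕ (c · p) (0ℤ ∷ (const d ⊗ p)) 0 ⟩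
  coeff (c · p) 0 +ℤ 0ℤ                      ≡⟨ ℤₚ.+-identityʳ _ ⟩
  coeff (c · p) 0                            ≡⟨ coeff-· c p 0 ⟩
  c *ℤ coeff p 0                             ∎

coeff-linear-⊗-suc : ∀ c d p i → coeff ((c ∷ d ∷ []) ⊗ p) (suc i) ≡ c *ℤ coeff p (suc i) +ℤ d *ℤ coeff p i
coeff-linear-⊗-suc c d p i = begin
  coeff ((c · p) ⊕ (0ℤ ∷ (const d ⊗ p))) (suc i)       ≡⟨ coeff-⊕ (c · p) (0ℤ ∷ (const d ⊗ p)) (suc i) ⟩
  coeff (c · p) (suc i) +ℤ coeff (const d ⊗ p) i       ≡⟨ cong₂ _+ℤ_ (coeff-· c p (suc i)) (coeff-const-⊗ d p i) ⟩
  c *ℤ coeff p (suc i) +ℤ d *ℤ coeff p i               ∎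

coeff-·X-⊗-0 : ∀ c p → coeff ((c · X) ⊗ p) 0 ≡ 0ℤ
coeff-·X-⊗-0 c p = trans (coeff-linear-⊗-0 (c *ℤ 0ℤ) (c *ℤ 1ℤ) p) (cong (_*ℤ coeff p 0) (ℤₚ.*-zeroʳ c))

coeff-·X-⊗-suc : ∀ c p i → coeff ((c · X) ⊗ p) (suc i) ≡ c *ℤ coeff p i
coeff-·X-⊗-suc c p i = trans (coeff-linear-⊗-suc (c *ℤ 0ℤ) (c *ℤ 1ℤ) p i) (simplify c (coeff p (suc i)) (coeff p i))
  where
  simplify : ∀ c x y → c *ℤ 0ℤ *ℤ x +ℤ c *ℤ 1ℤ *ℤ y ≡ c *ℤ y
  simplify = solve-∀

coeff-X^-≡ : ∀ i → coeff (X ^ₚ i) i ≡ 1ℤ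
coeff-X^-≡ zero    = refl
coeff-X^-≡ (suc i) = trans (coeff-·X-⊗-suc 1ℤ (X ^ₚ i) i) (trans (ℤₚ.*-identityˡ _) (coeff-X^-≡ i))

coeff-X^-≢ : ∀ i j → i ≢ j → coeff (X ^ₚ j) i ≡ 0ℤ
coeff-X^-≢ zero    zero    i≢j = contradiction refl i≢j
coeff-X^-≢ (suc i) zero    i≢j = refl
coeff-X^-≢ zero    (suc j) i≢j = coeff-·X-⊗-0 1ℤ (X ^ₚ j)
coeff-X^-≢ (suc i) (suc j) i≢j = trans (coeff-·X-⊗-suc 1ℤ (X ^ₚ j) i)
  (trans (ℤₚ.*-identityˡ _) (coeff-X^-≢ i j (i≢j ∘ cong suc)))

coeff-·X^-≡ : ∀ c i → coeff (c · (X ^ₚ i)) i ≡ c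
coeff-·X^-≡ c i = trans (coeff-· c (X ^ₚ i) i) (trans (cong (c *ℤ_) (coeff-X^-≡ i)) (ℤₚ.*-identityʳ c))

coeff-·X^-≢ : ∀ c i j → i ≢ j → coeff (c · (X ^ₚ j)) i ≡ 0ℤ
coeff-·X^-≢ c i j i≢j = trans (coeff-· c (X ^ₚ j) i) (trans (cong (c *ℤ_) (coeff-X^-≢ i j i≢j)) (ℤₚ.*-zeroʳ c))

coeff-foldr-∷ʳ : ∀ ps p i → coeff (foldr _⊕_ 0ₚ (ps ∷ʳ p)) i ≡ coeff (foldr _⊕_ 0ₚ ps) i +ℤ coeff p i
coeff-foldr-∷ʳ []       p i = trans (coeff-⊕ p [] i) (ℤₚ.+-comm (coeff p i) 0ℤ)
coeff-foldr-∷ʳ (q ∷ ps) p i = begin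
  coeff (q ⊕ foldr _⊕_ 0ₚ (ps ∷ʳ p)) i                        ≡⟨ coeff-⊕ q _ i ⟩
  coeff q i +ℤ coeff (foldr _⊕_ 0ₚ (ps ∷ʳ p)) i               ≡⟨ cong (coeff q i +ℤ_) (coeff-foldr-∷ʳ ps p i) ⟩
  coeff q i +ℤ (coeff (foldr _⊕_ 0ₚ ps) i +ℤ coeff p i)       ≡⟨ ℤₚ.+-assoc (coeff q i) _ _ ⟨
  coeff q i +ℤ coeff (foldr _⊕_ 0ₚ ps) i +ℤ coeff p i         ≡⟨ cong (_+ℤ coeff p i) (coeff-⊕ q _ i) ⟨
  coeff (q ⊕ foldr _⊕_ 0ₚ ps) i +ℤ coeff p i                  ∎

coeff-∑ : ∀ d f i → coeff (∑ 0 d f) i ≡ sum (suc d) λ j → coeff (f j) i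
coeff-∑ zero    f i = trans (coeff-⊕ (f 0) [] i) (ℤₚ.+-comm (coeff (f 0) i) 0ℤ)
coeff-∑ (suc d) f i = begin
  coeff (∑ 0 (suc d) f) i
    ≡⟨ cong (λ r → coeff (foldr _⊕_ 0ₚ (map f r)) i) (range-∷ʳ {0} {d} z≤n) ⟩
  coeff (foldr _⊕_ 0ₚ (map f (range 0 d ∷ʳ suc d))) i
    ≡⟨ cong (λ ps → coeff (foldr _⊕_ 0ₚ ps) i) (map-++ f (range 0 d) [ suc d ]) ⟩
  coeff (foldr _⊕_ 0ₚ (map f (range 0 d) ∷ʳ f (suc d))) i
    ≡⟨ coeff-foldr-∷ʳ (map f (range 0 d)) (f (suc d)) i ⟩
  coeff (∑ 0 d f) i +ℤ coeff (f (suc d)) i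
    ≡⟨ cong (_+ℤ coeff (f (suc d)) i) (coeff-∑ d f i) ⟩
  sum (suc (suc d)) (λ j → coeff (f j) i) ∎

sum-single : ∀ n f i → i < n → (∀ j → i ≢ j → f j ≡ 0ℤ) → sum n f ≡ f i
sum-single (suc n) f i i<1+n f≗0 with i ℕₚ.≟ n
... | yes refl = trans (cong (_+ℤ f i) (sum-zero n λ j j<n → f≗0 j λ { refl → ℕₚ.<-irrefl refl j<n })) (ℤₚ.+-identityˡ (f i))
... | no  i≢n  = trans (sum-extend n f (f≗0 n i≢n)) (sum-single n f i (ℕₚ.≤∧≢⇒< (s≤s⁻¹ i<1+n) i≢n) f≗0)

-- Each `f j` is a multiple of x^j up to `_≈_`. The inner sums over k in the formulas for Q qualify
-- as well, so single and double sums are treated alike.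
Graded : (ℕ → Poly) → Set
Graded f = ∀ i j → i ≢ j → coeff (f j) i ≡ 0ℤ

coeff-∑-≤ : ∀ d f i → Graded f → i ≤ d → coeff (∑ 0 d f) i ≡ coeff (f i) i
coeff-∑-≤ d f i graded i≤d = trans (coeff-∑ d f i) (sum-single (suc d) (λ j → coeff (f j) i) i (s≤s i≤d) (graded i))

coeff-∑-> : ∀ d f i → Graded f → d < i → coeff (∑ 0 d f) i ≡ 0ℤ
coeff-∑-> d f i graded d<i = trans (coeff-∑ d f i)
  (sum-zero (suc d) λ j j≤d → graded i j λ { refl → ℕₚ.<-irrefl refl (ℕₚ.<-≤-trans d<i (s≤s⁻¹ j≤d)) })

-- The recurrence read off coefficientwise, for an arbitrary solution R

private
  2+2c≡[1+c]*2 : ∀ c → 2 + 2 * c ≡ suc c * 2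
  2+2c≡[1+c]*2 c = cong (λ x → 2 + x) (ℕₚ.*-comm 2 c)

b-even : ∀ N c → b N (2 + 2 * c) ≡ (+ suc c) · X
b-even N c = trans (cong (b N) (2+2c≡[1+c]*2 c))
  (cong₂ (λ r q → if r ≡ᵇ 0 then (+ q) · X else (- + (N + q)) · X) (m*n%n≡0 (suc c) 2) (m*n/n≡m (suc c) 2))

b-odd : ∀ N c → b N (3 + 2 * c) ≡ (- + (N + suc c)) · X
b-odd N c = trans (cong (λ m → b N (suc m)) (2+2c≡[1+c]*2 c))
  (cong₂ (λ r q → if r ≡ᵇ 0 then (+ q) · X else (- + (N + q)) · X)
    ([m+kn]%n≡m%n 1 (suc c) 2)
    (trans (+-distrib-/-∣ʳ 1 {d = 2} (n∣m*n (suc c))) (m*n/n≡m (suc c) 2)))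

module _ (N : ℕ) (R : ℕ → Poly)
  (R-rec : ∀ n → R (suc (suc n)) ≡ a N (suc (suc n)) ⊗ R (suc n) ⊕ b N (suc (suc n)) ⊗ R n) where

  coeff-R-0 : ∀ n c → b N (2 + n) ≡ c · X → coeff (R (2 + n)) 0 ≡ + (N + (2 + n)) *ℤ coeff (R (1 + n)) 0
  coeff-R-0 n c b≡cX = begin
    coeff (R (2 + n)) 0
      ≡⟨ cong (λ p → coeff p 0) (R-rec n) ⟩
    coeff (a N (2 + n) ⊗ R (1 + n) ⊕ b N (2 + n) ⊗ R n) 0
      ≡⟨ coeff-⊕ (a N (2 + n) ⊗ R (1 + n)) _ 0 ⟩
    coeff (a N (2 + n) ⊗ R (1 + n)) 0 +ℤ coeff (b N (2 + n) ⊗ R n) 0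
      ≡⟨ cong₂ _+ℤ_ (coeff-const-⊗ (+ (N + (2 + n))) (R (1 + n)) 0)
           (trans (cong (λ q → coeff (q ⊗ R n) 0) b≡cX) (coeff-·X-⊗-0 c (R n))) ⟩
    + (N + (2 + n)) *ℤ coeff (R (1 + n)) 0 +ℤ 0ℤ
      ≡⟨ ℤₚ.+-identityʳ _ ⟩
    + (N + (2 + n)) *ℤ coeff (R (1 + n)) 0 ∎

  coeff-R-suc : ∀ n c → b N (2 + n) ≡ c · X → ∀ j →
    coeff (R (2 + n)) (suc j) ≡ + (N + (2 + n)) *ℤ coeff (R (1 + n)) (suc j) +ℤ c *ℤ coeff (R n) j
  coeff-R-suc n c b≡cX j = begin
    coeff (R (2 + n)) (suc j)
      ≡⟨ cong (λ p → coeff p (suc j)) (R-rec n) ⟩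
    coeff (a N (2 + n) ⊗ R (1 + n) ⊕ b N (2 + n) ⊗ R n) (suc j)
      ≡⟨ coeff-⊕ (a N (2 + n) ⊗ R (1 + n)) _ (suc j) ⟩
    coeff (a N (2 + n) ⊗ R (1 + n)) (suc j) +ℤ coeff (b N (2 + n) ⊗ R n) (suc j)
      ≡⟨ cong₂ _+ℤ_ (coeff-const-⊗ (+ (N + (2 + n))) (R (1 + n)) (suc j))
           (trans (cong (λ q → coeff (q ⊗ R n) (suc j)) b≡cX) (coeff-·X-⊗-suc c (R n) j)) ⟩
    + (N + (2 + n)) *ℤ coeff (R (1 + n)) (suc j) +ℤ c *ℤ coeff (R n) j ∎

  module _ (S : ℕ → ℕ → ℕ → ℤ) (S-closed : IsClosedForm N S) where
    open IsClosedForm S-closed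

    private
      factor : ∀ x y z → x *ℤ z - y *ℤ z ≡ (x - y) *ℤ z
      factor = solve-∀

      -- Expanding the subtracted term by the even-index identity leaves two terms with factor c +
      -- 1, which Pascal's rule merges into one at `suc c`. At j = 0 `pascal-0` and `step-0` take
      -- over.
      step-below : ∀ c m j → + suc c *ℤ S c m j - S (suc c) (suc m) j
        ≡ (+ suc c - + (N + suc m + j)) *ℤ S (suc c) m j
      step-below c m zero = begin
        + suc c *ℤ S c m 0 - S (suc c) (suc m) 0
          ≡⟨ cong₂ (λ x y → + suc c *ℤ x - y) (sym (pascal-0 c m)) (step-0 (suc c) m) ⟩
        + suc c *ℤ S (suc c) m 0 - + (N + suc m) *ℤ S (suc c) m 0
          ≡⟨ factor (+ suc c) (+ (N + suc m)) (S (suc c) m 0) ⟩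
        (+ suc c - + (N + suc m)) *ℤ S (suc c) m 0
          ≡⟨ cong (λ x → (+ suc c - + x) *ℤ S (suc c) m 0) (ℕₚ.+-identityʳ (N + suc m)) ⟨
        (+ suc c - + (N + suc m + 0)) *ℤ S (suc c) m 0 ∎
      step-below c m (suc j) = begin
        + suc c *ℤ S c m (suc j) - S (suc c) (suc m) (suc j)
          ≡⟨ cong (λ x → + suc c *ℤ S c m (suc j) - x) (step c m j) ⟩
        + suc c *ℤ S c m (suc j) - (A *ℤ S (suc c) m (suc j) +ℤ + suc c *ℤ S c m j)
          ≡⟨ regroup (+ suc c) A (S c m (suc j)) (S (suc c) m (suc j)) (S c m j) ⟩
        + suc c *ℤ (S c m (suc j) - S c m j) - A *ℤ S (suc c) m (suc j)
          ≡⟨ cong (λ x → + suc c *ℤ x - A *ℤ S (suc c) m (suc j)) (pascal c m j) ⟨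
        + suc c *ℤ S (suc c) m (suc j) - A *ℤ S (suc c) m (suc j)
          ≡⟨ factor (+ suc c) A (S (suc c) m (suc j)) ⟩
        (+ suc c - A) *ℤ S (suc c) m (suc j) ∎
        where
        A = + (N + suc m + suc j)
        regroup : ∀ γ x y z w → γ *ℤ y - (x *ℤ z +ℤ γ *ℤ w) ≡ γ *ℤ (y - w) - x *ℤ z
        regroup = solve-∀

    -- The odd-index recurrence before its coefficient is simplified. Only `suc c` occurs on the
    -- right, as it must: the indices 2c+1 and 2c+2 have the same half rounded up.
    step-pascal : ∀ c m j → S (2 + c) (suc m) (suc j)
      ≡ + (N + suc m + suc j) *ℤ S (suc c) m (suc j) +ℤ (+ suc c - + (N + suc m + j)) *ℤ S (suc c) m j
    step-pascal c m j = begin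
      S (2 + c) (suc m) (suc j)
        ≡⟨ pascal (suc c) (suc m) j ⟩
      S (suc c) (suc m) (suc j) - S (suc c) (suc m) j
        ≡⟨ cong (λ x → x - S (suc c) (suc m) j) (step c m j) ⟩
      x +ℤ + suc c *ℤ S c m j - S (suc c) (suc m) j
        ≡⟨ ℤₚ.+-assoc x (+ suc c *ℤ S c m j) (- S (suc c) (suc m) j) ⟩
      x +ℤ (+ suc c *ℤ S c m j - S (suc c) (suc m) j)
        ≡⟨ cong (x +ℤ_) (step-below c m j) ⟩
      x +ℤ (+ suc c - + (N + suc m + j)) *ℤ S (suc c) m j ∎
      where x = + (N + suc m + suc j) *ℤ S (suc c) m (suc j)

    -- The split is forced by m = n - j being a natural number: coefficients past x^n have no m, yet
    -- the recurrence refers to them.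
    record Closed (n c : ℕ) : Set where
      field
        within : ∀ m j → m + j ≡ n → coeff (R n) j ≡ S c m j
        beyond : ∀ j → n < j → coeff (R n) j ≡ 0ℤ
    open Closed

    -- Only the factor x in `b` raises the degree, by one in two steps of the index. The bound is
    -- therefore sharper by one than `beyond` at 2 + n asks; the extra exponent j = 2 + n is the
    -- case m = 0 of `within`, which `step` does not reach.
    beyond-suc-suc : ∀ n c c₀ c₁ → b N (2 + n) ≡ c · X → Closed n c₀ → Closed (1 + n) c₁ →
      ∀ j → 1 + n < j → coeff (R (2 + n)) j ≡ 0ℤ
    beyond-suc-suc n c c₀ c₁ b≡cX Rₙ Rₙ₊₁ (suc j) 1+n<1+j@(s≤s n<j) = begin
      coeff (R (2 + n)) (suc j)
        ≡⟨ coeff-R-suc n c b≡cX j ⟩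
      + (N + (2 + n)) *ℤ coeff (R (1 + n)) (suc j) +ℤ c *ℤ coeff (R n) j
        ≡⟨ cong₂ (λ x y → + (N + (2 + n)) *ℤ x +ℤ c *ℤ y) (beyond Rₙ₊₁ (suc j) 1+n<1+j) (beyond Rₙ j n<j) ⟩
      + (N + (2 + n)) *ℤ 0ℤ +ℤ c *ℤ 0ℤ
        ≡⟨ cong₂ _+ℤ_ (ℤₚ.*-zeroʳ (+ (N + (2 + n)))) (ℤₚ.*-zeroʳ c) ⟩
      0ℤ ∎

    closed-even : ∀ c → Closed (2 * c) c → Closed (1 + 2 * c) (suc c) → Closed (2 + 2 * c) (suc c)
    closed-even c Rₙ Rₙ₊₁ = record { within = within′ ; beyond = λ j → beyond′ j ∘ ℕₚ.<⇒≤ }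
      where
      n = 2 * c
      beyond′ = beyond-suc-suc n (+ suc c) c (suc c) (b-even N c) Rₙ Rₙ₊₁
      within′ : ∀ m j → m + j ≡ 2 + n → coeff (R (2 + n)) j ≡ S (suc c) m j
      within′ zero j refl = trans (beyond′ j ℕₚ.≤-refl) (sym (vanish c j (s≤s (s≤s (ℕₚ.m≤m+n c (c + 0))))))
      within′ (suc m) zero eq with refl ← trans (sym (ℕₚ.+-identityʳ m)) (ℕₚ.suc-injective eq) = begin
        coeff (R (2 + n)) 0                           ≡⟨ coeff-R-0 n (+ suc c) (b-even N c) ⟩
        + (N + (2 + n)) *ℤ coeff (R (1 + n)) 0        ≡⟨ cong (+ (N + (2 + n)) *ℤ_) (within Rₙ₊₁ (1 + n) 0 (ℕₚ.+-identityʳ (1 + n))) ⟩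
        + (N + (2 + n)) *ℤ S (suc c) (1 + n) 0        ≡⟨ step-0 (suc c) (1 + n) ⟨
        S (suc c) (2 + n) 0                           ∎
      within′ (suc m) (suc j) eq = begin
        coeff (R (2 + n)) (suc j)
          ≡⟨ coeff-R-suc n (+ suc c) (b-even N c) j ⟩
        + (N + (2 + n)) *ℤ coeff (R (1 + n)) (suc j) +ℤ + suc c *ℤ coeff (R n) j
          ≡⟨ cong₂ (λ x y → + (N + (2 + n)) *ℤ x +ℤ + suc c *ℤ y) (within Rₙ₊₁ m (suc j) m+1+j) (within Rₙ m j m+j) ⟩
        + (N + (2 + n)) *ℤ S (suc c) m (suc j) +ℤ + suc c *ℤ S c m j
          ≡⟨ cong (λ x → + x *ℤ S (suc c) m (suc j) +ℤ + suc c *ℤ S c m j)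
               (trans (ℕₚ.+-assoc N (suc m) (suc j)) (cong (λ x → N + x) eq)) ⟨
        + (N + suc m + suc j) *ℤ S (suc c) m (suc j) +ℤ + suc c *ℤ S c m j
          ≡⟨ step c m j ⟨
        S (suc c) (suc m) (suc j) ∎
        where
        m+1+j = ℕₚ.suc-injective eq
        m+j = ℕₚ.suc-injective (trans (sym (ℕₚ.+-suc m j)) m+1+j)

    closed-odd : ∀ c → Closed (1 + 2 * c) (1 + c) → Closed (2 + 2 * c) (1 + c) → Closed (3 + 2 * c) (2 + c)
    closed-odd c Rₙ Rₙ₊₁ = record { within = within′ ; beyond = λ j → beyond′ j ∘ ℕₚ.<⇒≤ }
      where
      n = 1 + 2 * c
      beyond′ = beyond-suc-suc n (- + (N + suc c)) (1 + c) (1 + c) (b-odd N c) Rₙ Rₙ₊₁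
      within′ : ∀ m j → m + j ≡ 2 + n → coeff (R (2 + n)) j ≡ S (2 + c) m j
      within′ zero j refl = trans (beyond′ j ℕₚ.≤-refl) (sym (vanish (suc c) j (s≤s (s≤s (s≤s (ℕₚ.m≤m+n c (c + 0)))))))
      within′ (suc m) zero eq with refl ← trans (sym (ℕₚ.+-identityʳ m)) (ℕₚ.suc-injective eq) = begin
        coeff (R (2 + n)) 0                           ≡⟨ coeff-R-0 n (- + (N + suc c)) (b-odd N c) ⟩
        + (N + (2 + n)) *ℤ coeff (R (1 + n)) 0        ≡⟨ cong (+ (N + (2 + n)) *ℤ_) (within Rₙ₊₁ (1 + n) 0 (ℕₚ.+-identityʳ (1 + n))) ⟩
        + (N + (2 + n)) *ℤ S (1 + c) (1 + n) 0        ≡⟨ step-0 (1 + c) (1 + n) ⟨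
        S (1 + c) (2 + n) 0                           ≡⟨ pascal-0 (1 + c) (2 + n) ⟨
        S (2 + c) (2 + n) 0                           ∎
      within′ (suc m) (suc j) eq = begin
        coeff (R (2 + n)) (suc j)
          ≡⟨ coeff-R-suc n (- + (N + suc c)) (b-odd N c) j ⟩
        + (N + (2 + n)) *ℤ coeff (R (1 + n)) (suc j) +ℤ - + (N + suc c) *ℤ coeff (R n) j
          ≡⟨ cong₂ (λ x y → + (N + (2 + n)) *ℤ x +ℤ - + (N + suc c) *ℤ y) (within Rₙ₊₁ m (suc j) m+1+j) (within Rₙ m j m+j) ⟩
        + (N + (2 + n)) *ℤ S (1 + c) m (suc j) +ℤ - + (N + suc c) *ℤ S (1 + c) m j
          ≡⟨ cong₂ (λ x y → + x *ℤ S (1 + c) m (suc j) +ℤ y *ℤ S (1 + c) m j)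
               (trans (ℕₚ.+-assoc N (suc m) (suc j)) (cong (λ x → N + x) eq)) slope ⟨
        + (N + suc m + suc j) *ℤ S (1 + c) m (suc j) +ℤ (+ suc c - + (N + suc m + j)) *ℤ S (1 + c) m j
          ≡⟨ step-pascal c m j ⟨
        S (2 + c) (suc m) (suc j) ∎
        where
        m+1+j = ℕₚ.suc-injective eq
        m+j = ℕₚ.suc-injective (trans (sym (ℕₚ.+-suc m j)) m+1+j)
        -- Since m + j = 2c + 1, the factor is c + 1 - (N + 2c + 2), which is exactly the
        -- coefficient in `b` at index 2c + 3.
        slope : + suc c - + (N + suc m + j) ≡ - + (N + suc c)
        slope = begin
          + suc c - + (N + suc m + j)
            ≡⟨ cong (λ x → + suc c - + x) (trans (ℕₚ.+-assoc N (suc m) j) (cong (λ x → N + suc x) m+j)) ⟩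
          + suc c - + (N + (2 + 2 * c))
            ≡⟨ cong (λ x → + suc c - + x) (split N c) ⟩
          + suc c - + (N + suc c + suc c)
            ≡⟨ cong (λ x → + suc c - x) (pos-+ (N + suc c) (suc c)) ⟩
          + suc c - (+ (N + suc c) +ℤ + suc c)
            ≡⟨ cancel (+ suc c) (+ (N + suc c)) ⟩
          - + (N + suc c) ∎
          where
          split : ∀ N c → N + (2 + 2 * c) ≡ N + (1 + c) + (1 + c)
          split = ℕ-Ring.solve-∀
          cancel : ∀ x y → x - (y +ℤ x) ≡ - y
          cancel = solve-∀

    closed : Closed 0 0 → Closed 1 1 → ∀ c → Closed (2 * c) c × Closed (1 + 2 * c) (1 + c)
    closed R₀ R₁ zero    = R₀ , R₁
    closed R₀ R₁ (suc c) with even , odd ← closed R₀ R₁ c =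
      subst (λ n → Closed n (1 + c)) (sym (ℕₚ.*-suc 2 c)) even′ ,
      subst (λ n → Closed (1 + n) (2 + c)) (sym (ℕₚ.*-suc 2 c)) (closed-odd c odd even′)
      where even′ = closed-even c even odd

    -- The sum stops at x^d, possibly well before x^n. For exponents in between, the closed form
    -- still describes the coefficient and must be seen to be zero.
    matches : ∀ {n c d} f → Closed n c → Graded f → d ≤ n →
      (∀ i → i ≤ d → coeff (f i) i ≡ S c (n ∸ i) i) →
      (∀ i → d < i → S c (n ∸ i) i ≡ 0ℤ) → R n ≈ ∑ 0 d f
    matches {n} {c} {d} f Rₙ graded d≤n diagonal vanishing i with ℕₚ.≤-<-connex i n | ℕₚ.≤-<-connex i d
    ... | inj₁ i≤n | inj₁ i≤d = trans (within Rₙ (n ∸ i) i (ℕₚ.m∸n+n≡m i≤n))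
      (sym (trans (coeff-∑-≤ d f i graded i≤d) (diagonal i i≤d)))
    ... | inj₁ i≤n | inj₂ d<i = trans (within Rₙ (n ∸ i) i (ℕₚ.m∸n+n≡m i≤n))
      (trans (vanishing i d<i) (sym (coeff-∑-> d f i graded d<i)))
    ... | inj₂ n<i | _        = trans (beyond Rₙ i n<i)
      (sym (coeff-∑-> d f i graded (ℕₚ.≤-<-trans d≤n n<i)))

-- Numerators and denominators as instances, and their explicit sums

P-Closed : ℕ → ℕ → ℕ → Set
P-Closed N = Closed N (P N) (λ _ → refl) (P-coeff N) (P-coeff-isClosedForm N)

P-closed : ∀ N c → P-Closed N (2 * c) c × P-Closed N (1 + 2 * c) (1 + c)
P-closed N = closed N (P N) (λ _ → refl) (P-coeff N) (P-coeff-isClosedForm N)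
  (record { within = λ { zero zero refl → refl } ; beyond = λ { (suc j) _ → refl } })
  (record
    { within = λ { zero (suc zero) refl → refl
                 ; (suc zero) zero refl → trans (ℤₚ.+-identityʳ (+ (N + 1)))
                     (trans (cong +_ (sym (ℕₚ.*-identityʳ (N + 1)))) (sym (ℤₚ.*-identityˡ (+ ((N + 1) * 1))))) }
    ; beyond = λ { (suc (suc j)) _ → refl ; (suc zero) (s≤s ()) } })

Q-Closed : ℕ → ℕ → ℕ → Set
Q-Closed N = Closed N (Q N) (λ _ → refl) (Q-coeff N) (Q-coeff-isClosedForm N)

Q-closed : ∀ N c → Q-Closed N (2 * c) c × Q-Closed N (1 + 2 * c) (1 + c)
Q-closed N = closed N (Q N) (λ _ → refl) (Q-coeff N) (Q-coeff-isClosedForm N)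
  -- For Q_0 the half c is 0, so the upper argument is -1 and the value binom(-1,0) = 1 is what
  -- gives the constant 1.
  (record { within = λ { zero zero refl → refl } ; beyond = λ { (suc j) _ → refl } })
  (record
    { within = λ { zero (suc zero) refl → sym (Q-coeff-vanish N 1 0 1 (s≤s z≤n) (s≤s z≤n))
                 ; (suc zero) zero refl → sym (trans (Q-coeff-0 N 1 1) (cong +_
                     (trans (weight-0 N 1) (ℕₚ.*-identityʳ (N + 1))))) }
    ; beyond = λ { (suc j) _ → refl } })

graded-· : ∀ (g : ℕ → ℤ) → Graded (λ j → g j · (X ^ₚ j))
graded-· g i j = coeff-·X^-≢ (g j) i j

graded-∑ : ∀ (g : ℕ → ℕ → ℤ) → Graded (λ j → ∑[ k from 0 to j ] g j k · (X ^ₚ j))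
graded-∑ g i j i≢j = trans (coeff-∑ j (λ k → g j k · (X ^ₚ j)) i)
  (sum-zero (suc j) λ k _ → coeff-·X^-≢ (g j k) i j i≢j)

coeff-∑-diagonal : ∀ (g : ℕ → ℕ → ℤ) i → coeff (∑[ k from 0 to i ] g i k · (X ^ₚ i)) i ≡ sum (suc i) (g i)
coeff-∑-diagonal g i = trans (coeff-∑ i (λ k → g i k · (X ^ₚ i)) i)
  (sum-cong (suc i) λ k _ → coeff-·X^-≡ (g i k) i)

-- Written exactly as in the theorem, with `m` for the varying upper end, so that no rewriting under
-- the two sums is required at the end.
Q-coeff-term : ℕ → ℕ → ℕ → ℕ → ℕ → ℤ
Q-coeff-term N n m j k =
  (-1ℤ ^ (j ∸ k)) *ℤ + (m ↓ k) *ℤ binom (+ n - + k - + 1) (j ∸ k) *ℤ + (∏[ l from k + 1 to m ] (N + l))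

Q-coeff-term≡ : ∀ N n m {j k} → k ≤ j → Q-coeff-term N n m j k ≡ alt (+ n - 1ℤ) j k *ℤ + weight N m k
Q-coeff-term≡ N n m {j} {k} k≤j = begin
  s *ℤ + (m ↓ k) *ℤ binom (+ n - + k - + 1) (j ∸ k) *ℤ + p
    ≡⟨ regroup s (+ (m ↓ k)) (binom (+ n - + k - + 1) (j ∸ k)) (+ p) ⟩
  s *ℤ binom (+ n - + k - + 1) (j ∸ k) *ℤ (+ (m ↓ k) *ℤ + p)
    ≡⟨ cong₂ (λ z w → s *ℤ binom z (j ∸ k) *ℤ w) (swap (+ n) (+ k)) (sym (pos-* (m ↓ k) p)) ⟩
  s *ℤ binom (+ n - 1ℤ - + k) (j ∸ k) *ℤ + weight N m k
    ≡⟨ cong (_*ℤ + weight N m k) (alt-≤ (+ n - 1ℤ) k≤j) ⟨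
  alt (+ n - 1ℤ) j k *ℤ + weight N m k ∎
  where
  s = -1ℤ ^ (j ∸ k)
  p = ∏[ l from k + 1 to m ] (N + l)
  regroup : ∀ s x y p → s *ℤ x *ℤ y *ℤ p ≡ s *ℤ y *ℤ (x *ℤ p)
  regroup = solve-∀
  swap : ∀ x y → x - y - + 1 ≡ x - 1ℤ - y
  swap = solve-∀

-- The function `e` reconciles `2 * n ∸ j ∸ 1` in the theorem with `2 * n ∸ 1 ∸ j` in the closed
-- form: they agree only propositionally, and `j` is bound by the sum.
P-≈ : ∀ N n {d} (e : ℕ → ℕ) → (∀ j → e j ≡ d ∸ j) → n ≤ d →
  P-Closed N d n →
  P N d ≈ ∑[ j from 0 to n ] P-coeff N n (e j) j · (X ^ₚ j)
P-≈ N n {d} e e≗d∸ n≤d P-d = matches N (P N) (λ _ → refl) (P-coeff N) (P-coeff-isClosedForm N)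
  (λ j → P-coeff N n (e j) j · (X ^ₚ j)) P-d
  (graded-· λ j → P-coeff N n (e j) j) n≤d
  (λ i _ → trans (coeff-·X^-≡ (P-coeff N n (e i) i) i) (cong (λ m → P-coeff N n m i) (e≗d∸ i)))
  (λ i → P-coeff-vanish N n (d ∸ i) i)

Q-≈ : ∀ N n t {d} (e : ℕ → ℕ) → (∀ j → e j ≡ d ∸ j) → t ≤ d →
  (∀ i → t < i → d ∸ i < n × n ≤ i) →
  Q-Closed N d n →
  Q N d ≈ ∑[ j from 0 to t ] ∑[ k from 0 to j ] Q-coeff-term N n (e j) j k · (X ^ₚ j)
Q-≈ N n t {d} e e≗d∸ t≤d above-t Q-d = matches N (Q N) (λ _ → refl) (Q-coeff N) (Q-coeff-isClosedForm N)
  (λ j → ∑[ k from 0 to j ] Q-coeff-term N n (e j) j k · (X ^ₚ j)) Q-d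
  (graded-∑ λ j → Q-coeff-term N n (e j) j) t≤d
  (λ i _ → begin
    coeff (∑[ k from 0 to i ] Q-coeff-term N n (e i) i k · (X ^ₚ i)) i
      ≡⟨ coeff-∑-diagonal (λ j → Q-coeff-term N n (e j) j) i ⟩
    sum (suc i) (Q-coeff-term N n (e i) i)
      ≡⟨ sum-cong (suc i) (λ k k≤i → Q-coeff-term≡ N n (e i) (s≤s⁻¹ k≤i)) ⟩
    Q-coeff N n (e i) i
      ≡⟨ cong (λ m → Q-coeff N n m i) (e≗d∸ i) ⟩
    Q-coeff N n (d ∸ i) i ∎)
  (λ i t<i → let d∸i<n , n≤i = above-t i t<i in Q-coeff-vanish N n (d ∸ i) i d∸i<n n≤i)

∸-∸-comm : ∀ m i j → m ∸ i ∸ j ≡ m ∸ j ∸ i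
∸-∸-comm m i j = trans (ℕₚ.∸-+-assoc m i j) (trans (cong (m ∸_) (ℕₚ.+-comm i j)) (sym (ℕₚ.∸-+-assoc m j i)))

theorem4 : ∀ (N n : ℕ) → 1 ≤ N → 1 ≤ n →
    (P N (2 * n ∸ 1) ≈
    ∑[ j from 0 to n ]
    ((-1ℤ ^ j) *ℤ binom (+ n) j *ℤ + (∏[ l from 1 to 2 * n ∸ j ∸ 1 ] (N + l))) · (X ^ₚ j))
    × (P N (2 * n) ≈
    ∑[ j from 0 to n ]
    ((-1ℤ ^ j) *ℤ binom (+ n) j *ℤ + (∏[ l from 1 to 2 * n ∸ j ] (N + l))) · (X ^ₚ j))
    × (Q N (2 * n ∸ 1) ≈
    ∑[ j from 0 to n ∸ 1 ] ∑[ k from 0 to j ]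
    ((-1ℤ ^ (j ∸ k)) *ℤ + ((2 * n ∸ j ∸ 1) ↓ k) *ℤ binom (+ n - + k - + 1) (j ∸ k)
    *ℤ + (∏[ l from k + 1 to 2 * n ∸ j ∸ 1 ] (N + l))) · (X ^ₚ j))
    × (Q N (2 * n) ≈
    ∑[ j from 0 to n ] ∑[ k from 0 to j ]
    ((-1ℤ ^ (j ∸ k)) *ℤ + ((2 * n ∸ j) ↓ k) *ℤ binom (+ n - + k - + 1) (j ∸ k)
    *ℤ + (∏[ l from k + 1 to 2 * n ∸ j ] (N + l))) · (X ^ₚ j))
theorem4 N n@(suc c) _ _ =
    P-≈ N n (λ j → 2 * n ∸ j ∸ 1) (λ j → ∸-∸-comm (2 * n) j 1) n≤2n∸1
      (subst (λ d → P-Closed N d n) 1+2c≡2n∸1 (proj₂ (P-closed N c)))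
  , P-≈ N n (λ j → 2 * n ∸ j) (λ _ → refl) n≤2n (proj₁ (P-closed N n))
  , Q-≈ N n c (λ j → 2 * n ∸ j ∸ 1) (λ j → ∸-∸-comm (2 * n) j 1) (ℕₚ.≤-trans (ℕₚ.n≤1+n c) n≤2n∸1)
      (λ i c<i → below-n c<i , c<i)
      (subst (λ d → Q-Closed N d n) 1+2c≡2n∸1 (proj₂ (Q-closed N c)))
  , Q-≈ N n n (λ j → 2 * n ∸ j) (λ _ → refl) n≤2n
      -- `2 * n ∸ suc i` computes to `2 * n ∸ 1 ∸ i`, so the bound for the odd index serves here
      -- too, shifted by one.
      (λ { (suc i) (s≤s n≤i) → below-n n≤i , ℕₚ.m≤n⇒m≤1+n n≤i }) (proj₁ (Q-closed N n))
  where
  1+2c≡2n∸1 : 1 + 2 * c ≡ 2 * n ∸ 1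
  1+2c≡2n∸1 = sym (ℕₚ.+-suc c (c + 0))

  n≤2n∸1 : n ≤ 2 * n ∸ 1
  n≤2n∸1 = subst (n ≤_) 1+2c≡2n∸1 (s≤s (ℕₚ.m≤m+n c (c + 0)))

  n≤2n : n ≤ 2 * n
  n≤2n = ℕₚ.m≤m+n n (n + 0)

  -- From exponent n on, m is at most (2n-1) - n = n - 1, and `Q-coeff-vanish` applies. This is why
  -- the sum for Q_{2n-1} ends at n - 1, whereas in Q_{2n} the exponent n has m = n and stays.
  below-n : ∀ {i} → n ≤ i → 2 * n ∸ 1 ∸ i < n
  below-n {i} n≤i = s≤s (ℕₚ.≤-trans (ℕₚ.∸-monoʳ-≤ (2 * n ∸ 1) n≤i)
    (ℕₚ.≤-reflexive (trans (cong (_∸ n) (ℕₚ.+-suc c (c + 0))) (trans (ℕₚ.m+n∸m≡n c (c + 0)) (ℕₚ.+-identityʳ c)))))
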